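{- For every integer $n\ge0$, $A_3(n)=C_{3,3}(n)$, where $A_3(n)$ is the number of partitions $\lambda$ of $n$ for which there exists an integer $j\ge 0$ such that $m_{2i-1}(\lambda)=2$ for every $1\le i\le j$ and every part of $\lambda$ greater than $2j$ has multiplicity at most $1$ (i.e., if $2j-1$ is the largest repeated odd part, then all positive odd integers less than $2j$ appear exactly twice and no part greater than $2j$ is repeated; even parts at most $2j$ are unrestricted), and $C_{3,3}(n)$ is the number of partitions of $n$ into parts $\not\equiv 0,\pm3\pmod 7$.
   Context: $m_j(\lambda)$ denotes the number of times $j$ appears as a part of the partition $\lambda$. -}

module Defs where

open import Data.Empty using (⊥-elim)
open import Data.List.Base
  using (List; []; _∷_; concatMap; filter; length)
open import Data.List.Membership.Propositional using (_∈_; lose)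
open import Data.List.Membership.Propositional.Properties
  using (∈-concatMap⁺; ∈-filter⁺; ∈-filter⁻; ∈-++⁻)
open import Data.List.Relation.Unary.All as All using (All; []; _∷_)
open import Data.List.Relation.Unary.AllPairs using ([]; _∷_)
open import Data.List.Relation.Unary.Any using (here; there)
open import Data.List.Relation.Unary.Linked using (Linked; linked?)
open import Data.List.Relation.Unary.Unique.Propositional using (Unique)
import Data.List.Relation.Unary.Unique.Propositional.Properties as Unique
open import Data.Nat.Base
open import Data.Nat.DivMod using (_%_)
open import Data.Nat.ListAction using (sum)
open import Data.Nat.Properties
open import Data.Product.Base using (_×_; _,_; ∃-syntax; proj₁)
open import Data.Sum.Base using (inj₁; inj₂)
open import Function.Base using (_∘_)
open import Relation.Binary.PropositionalEquality
open import Relation.Nullary.Decidable using (Dec; map′; ¬?; _×-dec_; _→-dec_)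
open import Relation.Unary using (Pred; Decidable)

record IsPartition (n : ℕ) (ps : List ℕ) : Set where
  constructor isPartition
  field
    positive      : All (0 <_) ps
    nonincreasing : Linked _≥_ ps
    total         : sum ps ≡ n

-- Every composition of suc n arises exactly once from a composition of n, by
-- prepending a part 1 or by increasing the first part.
grow : List ℕ → List (List ℕ)
grow []       = (1 ∷ []) ∷ []
grow (p ∷ ps) = (1 ∷ p ∷ ps) ∷ (suc p ∷ ps) ∷ []

compositions : ℕ → List (List ℕ)
compositions zero    = [] ∷ []
compositions (suc n) = concatMap grow (compositions n)

-- By ∈-partitions⁺, ∈-partitions⁻ and partitions-unique below, this lists
-- every partition of n exactly once.
partitions : ℕ → List (List ℕ)
partitions n = filter (linked? _≥?_) (compositions n)

#partitions : ∀ {ℓ} {P : Pred (List ℕ) ℓ} → Decidable P → ℕ → ℕ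
#partitions P? n = length (filter P? (partitions n))

m : ℕ → List ℕ → ℕ
m j ps = length (filter (j ≟_) ps)

-- ∸ is truncated, but 2 * i ∸ 1 is only used for i ≥ 1.
A₃-witness : List ℕ → ℕ → Set
A₃-witness ps j =
  (∀ i → 1 ≤ i → i ≤ j → m (2 * i ∸ 1) ps ≡ 2) ×
  (∀ p → p ∈ ps → 2 * j < p → m p ps ≤ 1)

IsA₃ : Pred (List ℕ) _
IsA₃ ps = ∃[ j ] A₃-witness ps j

-- The residue 4 is −3 modulo 7.
IsC₃₃ : Pred (List ℕ) _
IsC₃₃ ps = ∀ p → p ∈ ps → p % 7 ≢ 0 × p % 7 ≢ 3 × p % 7 ≢ 4

private
  all∈? : ∀ {ℓ} {P : Pred ℕ ℓ} → Decidable P →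
          ∀ ps → Dec (∀ p → p ∈ ps → P p)
  all∈? P? ps = map′ (λ ps⊆P p → All.lookup ps⊆P) (λ f → All.tabulate (f _))
                     (All.all? P? ps)

  A₃-witness? : ∀ ps → Decidable (A₃-witness ps)
  A₃-witness? ps j =
    map′ (λ f i 1≤i i≤j → f {i} (s≤s i≤j) 1≤i) (λ f {i} i<1+j 1≤i → f i 1≤i (≤-pred i<1+j))
         (allUpTo? (λ i → (1 ≤? i) →-dec (m (2 * i ∸ 1) ps ≟ 2)) (suc j))
    ×-dec
    all∈? (λ p → (2 * j <? p) →-dec (m p ps ≤? 1)) ps

  m≢0⇒≤sum : ∀ j ps → m j ps ≢ 0 → j ≤ sum ps
  m≢0⇒≤sum j ps m≢0 with filter (j ≟_) ps in eq
  ... | []    = ⊥-elim (m≢0 refl)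
  ... | q ∷ _ with ∈-filter⁻ (j ≟_) {xs = ps} (subst (q ∈_) (sym eq) (here refl))
  ...   | q∈ps , refl = ∈⇒≤sum q∈ps
    where
    ∈⇒≤sum : ∀ {q qs} → q ∈ qs → q ≤ sum qs
    ∈⇒≤sum (here refl)              = m≤m+n _ _
    ∈⇒≤sum {qs = r ∷ _} (there q∈qs) = ≤-trans (∈⇒≤sum q∈qs) (m≤n+m _ r)

  witness≤sum : ∀ ps j → A₃-witness ps j → j ≤ sum ps
  witness≤sum ps zero    _       = z≤n
  witness≤sum ps (suc j) (w , _) =
    ≤-trans (≤-trans (m≤n+m (suc j) j) (+-monoʳ-≤ j (s≤s (m≤m+n j 0))))
            (m≢0⇒≤sum _ ps λ m≡0 → 0≢2 (trans (sym m≡0) (w (suc j) (s≤s z≤n) ≤-refl)))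
    where
    0≢2 : 0 ≢ 2
    0≢2 ()

IsA₃? : Decidable IsA₃
IsA₃? ps = map′ (λ (j , _ , w) → j , w)
                (λ (j , w) → j , s≤s (witness≤sum ps j w) , w)
                (anyUpTo? (A₃-witness? ps) (suc (sum ps)))

IsC₃₃? : Decidable IsC₃₃
IsC₃₃? = all∈? λ p →
  ¬? (p % 7 ≟ 0) ×-dec ¬? (p % 7 ≟ 3) ×-dec ¬? (p % 7 ≟ 4)

A₃ : ℕ → ℕ
A₃ = #partitions IsA₃?

C₃₃ : ℕ → ℕ
C₃₃ = #partitions IsC₃₃?

private
  ∈-grow⁻ : ∀ {n} ps qs → All (0 <_) ps → sum ps ≡ n → qs ∈ grow ps →
            All (0 <_) qs × sum qs ≡ suc n
  ∈-grow⁻ []       _ _          eq (here refl)         = (s≤s z≤n ∷ []) , cong suc eq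
  ∈-grow⁻ (p ∷ ps) _ pos        eq (here refl)         = (s≤s z≤n ∷ pos) , cong suc eq
  ∈-grow⁻ (p ∷ ps) _ (_ ∷ pos)  eq (there (here refl)) = (s≤s z≤n ∷ pos) , cong suc eq

  ∈-compositions⁻ : ∀ n {ps} → ps ∈ compositions n → All (0 <_) ps × sum ps ≡ n
  ∈-compositions⁻ zero    (here refl) = [] , refl
  ∈-compositions⁻ (suc n) {ps} ps∈    = go (compositions n) (∈-compositions⁻ n) ps∈
    where
    go : ∀ cs → (∀ {c} → c ∈ cs → All (0 <_) c × sum c ≡ n) →
         ps ∈ concatMap grow cs → All (0 <_) ps × sum ps ≡ suc n
    go (c ∷ cs) ok ps∈ with ∈-++⁻ (grow c) ps∈
    ... | inj₁ ps∈c  = let pos , eq = ok (here refl) in ∈-grow⁻ c ps pos eq ps∈c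
    ... | inj₂ ps∈cs = go cs (ok ∘ there) ps∈cs

  ∈-compositions⁺ : ∀ n ps → All (0 <_) ps → sum ps ≡ n → ps ∈ compositions n
  ∈-compositions⁺ zero    []                  _         _  = here refl
  ∈-compositions⁺ zero    (suc _ ∷ _)         _         ()
  ∈-compositions⁺ n       (zero ∷ _)          (() ∷ _)  _
  ∈-compositions⁺ (suc n) (1 ∷ ps)            (_ ∷ pos) eq =
    ∈-concatMap⁺ grow (lose (∈-compositions⁺ n ps pos (suc-injective eq)) (prepend ps))
    where
    prepend : ∀ qs → (1 ∷ qs) ∈ grow qs
    prepend []      = here refl
    prepend (_ ∷ _) = here refl
  ∈-compositions⁺ (suc n) (suc (suc p) ∷ ps)  (_ ∷ pos) eq =
    ∈-concatMap⁺ grow (lose (∈-compositions⁺ n (suc p ∷ ps) (s≤s z≤n ∷ pos) (suc-injective eq))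
                            (there (here refl)))

  shrink : List ℕ → List ℕ
  shrink []               = []
  shrink (suc (suc p) ∷ ps) = suc p ∷ ps
  shrink (_ ∷ ps)         = ps

  shrink-grow : ∀ {ps qs} → All (0 <_) ps → qs ∈ grow ps → shrink qs ≡ ps
  shrink-grow {[]}          _        (here refl)         = refl
  shrink-grow {_ ∷ _}       _        (here refl)         = refl
  shrink-grow {zero ∷ _}    (() ∷ _) (there (here refl))
  shrink-grow {suc _ ∷ _}   _        (there (here refl)) = refl

  grow-unique : ∀ {ps} → All (0 <_) ps → Unique (grow ps)
  grow-unique {[]}        _        = [] ∷ []
  grow-unique {zero ∷ _}  (() ∷ _)
  grow-unique {suc _ ∷ _} _        = ((λ ()) ∷ []) ∷ [] ∷ []

  shrink-concatMap : ∀ {cs qs} → All (All (0 <_)) cs →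
                     qs ∈ concatMap grow cs → shrink qs ∈ cs
  shrink-concatMap {c ∷ cs} (pos ∷ poss) qs∈ with ∈-++⁻ (grow c) qs∈
  ... | inj₁ qs∈c  = here (shrink-grow pos qs∈c)
  ... | inj₂ qs∈cs = there (shrink-concatMap poss qs∈cs)

  concatMap-grow-unique : ∀ {cs} → All (All (0 <_)) cs → Unique cs →
                          Unique (concatMap grow cs)
  concatMap-grow-unique []           []           = []
  concatMap-grow-unique (pos ∷ poss) (c∉cs ∷ cs!) =
    Unique.++⁺ (grow-unique pos) (concatMap-grow-unique poss cs!)
      λ (qs∈c , qs∈cs) →
        All.lookup c∉cs (shrink-concatMap poss qs∈cs) (sym (shrink-grow pos qs∈c))

  compositions-unique : ∀ n → Unique (compositions n)
  compositions-unique zero    = [] ∷ []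
  compositions-unique (suc n) =
    concatMap-grow-unique (All.tabulate (proj₁ ∘ ∈-compositions⁻ n)) (compositions-unique n)

∈-partitions⁺ : ∀ {n ps} → IsPartition n ps → ps ∈ partitions n
∈-partitions⁺ {n} {ps} (isPartition pos dec eq) =
  ∈-filter⁺ (linked? _≥?_) (∈-compositions⁺ n ps pos eq) dec

∈-partitions⁻ : ∀ {n ps} → ps ∈ partitions n → IsPartition n ps
∈-partitions⁻ {n} ps∈ =
  let ps∈cs , dec = ∈-filter⁻ (linked? _≥?_) {xs = compositions n} ps∈
      pos , eq    = ∈-compositions⁻ n ps∈cs
  in isPartition pos dec eq

partitions-unique : ∀ n → Unique (partitions n)
partitions-unique n = Unique.filter⁺ (linked? _≥?_) (compositions-unique n)

module Submission where

-- Put F(m) = Σ_j q^(2mj + 2j²) / ((1 − q²) ⋯ (1 − q^(2j))) · Π_{k>0} (1 + q^(m+2j+k)).  The j-th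
-- term of F(0) generates the partitions counted by A₃ whose witness is j, and the witness is
-- unique, so F(0) generates A₃.  Both F and the Rogers–Selberg sum
--   G(m) = Σ_n (−1)^n q^(n(7n+1)/2 + 3mn) (1 − q^(3(m+2n+1))) Π_{i≤m} (1 − q^(n+i))
-- satisfy X(m) + q^(3m+5) X(m+3) = (1 + q^(m+1)) X(m+1) + q^(2m+2) X(m+2), and for large m
-- they tend to 1 and to E = Π_{i>0} (1 − q^i); hence G = E F.  At m = 0 the sum G is a theta
-- series, equal to Π_{i>0, i ≡ 0, ±3 (mod 7)} (1 − q^i) by Jacobi's triple product, and dividing
-- by E leaves the generating function of C₃₃.  To compare coefficients of q^n it suffices to
-- work modulo q^(n+1), where all these sums and products are finite.

open import Algebra.Bundles using (CommutativeMonoid; CommutativeRing; RawRing)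
import Algebra.Properties.CommutativeSemigroup
import Algebra.Properties.Ring
import Algebra.Properties.Semiring.Mult
import Algebra.Solver.Ring
open import Algebra.Solver.Ring.AlmostCommutativeRing
  using (AlmostCommutativeRing; fromCommutativeRing; _-Raw-AlmostCommutative⟶_; Induced-equivalence)
open import Data.Bool.Base using (Bool; true; false; if_then_else_)
open import Data.Empty using (⊥; ⊥-elim)
open import Data.Integer.Base as ℤ using (ℤ; +_; 0ℤ; 1ℤ)
import Data.Integer.Properties as ℤ
import Data.Integer.Tactic.RingSolver as ℤ-Solver
open import Data.List.Base
  using (List; []; _∷_; _++_; foldr; downFrom; concatMap; filter; length; map; replicate)
open import Data.List.Membership.Propositional using (_∈_; find; lose)
open import Data.List.Membership.Propositional.Properties
  using (∈-concatMap⁺; ∈-concatMap⁻; ∈-map⁺; ∈-map⁻; ∈-downFrom⁺; ∈-filter⁺; ∈-filter⁻)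
open import Data.List.Membership.Propositional.Properties.WithK using (unique∧set⇒bag)
import Data.List.Properties as List
open import Data.List.Relation.Binary.BagAndSetEquality using (∼bag⇒↭)
open import Data.List.Relation.Binary.Permutation.Propositional.Properties using (↭-length)
open import Data.List.Relation.Unary.All as All using (All; []; _∷_)
import Data.List.Relation.Unary.All.Properties as All
open import Data.List.Relation.Unary.AllPairs using ([]; _∷_)
open import Data.List.Relation.Unary.Any using (here; there)
open import Data.List.Relation.Unary.Linked as Linked using (Linked; []; [-]; _∷_)
import Data.List.Relation.Unary.Linked.Properties as Linked
open import Data.List.Relation.Unary.Unique.Propositional using (Unique)
import Data.List.Relation.Unary.Unique.Propositional.Properties as Unique
open import Data.Maybe.Base using (just; nothing)
open import Data.Nat.Base
open import Data.Nat.DivMod using (_%_; _/_; [m+kn]%n≡m%n; m≡m%n+[m/n]*n)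
open import Data.Nat.ListAction using (sum)
import Data.Nat.Properties as ℕ
open import Data.List.Membership.DecPropositional ℕ._≟_ using (_∈?_)
open import Data.Nat.Tactic.RingSolver using (solve-∀)
open import Data.Product.Base using (_×_; _,_; ∃-syntax)
open import Data.Sum.Base using (_⊎_; inj₁; inj₂)
open import Defs
open import Function.Base using (_∘_; flip)
open import Function.Bundles using (mk⇔)
import Level
open import Relation.Binary.Definitions using (WeaklyDecidable; tri<; tri≈; tri>)
open import Relation.Binary.PropositionalEquality as ≡ using (_≡_; _≢_)
import Relation.Binary.Reasoning.Setoid
open import Relation.Nullary using (¬_; contradiction)
open import Relation.Nullary.Decidable using (yes; no; does; dec-true; dec-false)

-- The parameter m plays the part of a second variable x = q^m, so that Selberg's functional
-- equations in x become recurrences in m over a ring with the single variable q. G(m) is (q)_m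
-- times Selberg's function at x = q^m; this factor clears the denominators (q)_n of the summands. G
-- is handled inside the family `K 3 0`, `K 2 1`, `K 1 2`, `K 0 3`: neighbours differ by a mirrored
-- member at m + 1, and eliminating the middle members gives the recurrence. It expresses X(m) by
-- X(m+1), X(m+2), X(m+3), so agreement for all m ≥ M descends to m = 0. Two kinds of arithmetic are
-- kept apart: powers of q enter through an abstract `e` that turns sums into products, so
-- identities between exponents go to a solver on ℕ, while the ring solver treats each power as an
-- atom. Division never occurs: 1/(1 - q^d) is a finite geometric series, and E is cancelled because
-- it is a unit, which matters in a ring with nilpotents.

-- Finite sums and products in a commutative monoid.

module Iteration {c ℓ} (M : CommutativeMonoid c ℓ) where
  open CommutativeMonoid M
  open Algebra.Properties.CommutativeSemigroup commutativeSemigroup using (interchange)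
  open Relation.Binary.Reasoning.Setoid setoid

  iterate : ℕ → (ℕ → Carrier) → Carrier
  iterate zero    f = ε
  iterate (suc n) f = iterate n f ∙ f n

  iterate-cong< : ∀ n {f g} → (∀ i → i < n → f i ≈ g i) → iterate n f ≈ iterate n g
  iterate-cong< zero    f≈g = refl
  iterate-cong< (suc n) f≈g =
    ∙-cong (iterate-cong< n λ i i<n → f≈g i (ℕ.m<n⇒m<1+n i<n)) (f≈g n ℕ.≤-refl)

  iterate-cong : ∀ n {f g} → (∀ i → f i ≈ g i) → iterate n f ≈ iterate n g
  iterate-cong n f≈g = iterate-cong< n λ i _ → f≈g i

  iterate-ε : ∀ n {f} → (∀ i → i < n → f i ≈ ε) → iterate n f ≈ ε
  iterate-ε zero    f≈ε = refl
  iterate-ε (suc n) f≈ε =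
    trans (∙-cong (iterate-ε n λ i i<n → f≈ε i (ℕ.m<n⇒m<1+n i<n)) (f≈ε n ℕ.≤-refl)) (identityˡ ε)

  iterate-∙ : ∀ n f g → iterate n (λ i → f i ∙ g i) ≈ iterate n f ∙ iterate n g
  iterate-∙ zero    f g = sym (identityˡ ε)
  iterate-∙ (suc n) f g = trans (∙-congʳ (iterate-∙ n f g)) (interchange _ _ _ _)

  iterate-head : ∀ n f → iterate (suc n) f ≈ f 0 ∙ iterate n (f ∘ suc)
  iterate-head zero    f = comm ε (f 0)
  iterate-head (suc n) f = trans (∙-congʳ (iterate-head n f)) (assoc _ _ _)

  iterate-+ : ∀ m n f → iterate (n + m) f ≈ iterate m f ∙ iterate n (λ i → f (i + m))
  iterate-+ m zero    f = sym (identityʳ _)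
  iterate-+ m (suc n) f = trans (∙-congʳ (iterate-+ m n f)) (assoc _ _ _)

  -- Cuts a product into blocks of length k; blocks of 7 and of 2 later separate the residue classes
  -- of the part sizes.
  iterate-* : ∀ n k f → iterate (n * k) f ≈ iterate n (λ i → iterate k (λ j → f (j + i * k)))
  iterate-* zero    k f = refl
  iterate-* (suc n) k f = trans (iterate-+ (n * k) k f) (∙-congʳ (iterate-* n k f))

-- Solving ring identities with integer coefficients.

module RingSolver {c ℓ} (R : CommutativeRing c ℓ) where
  open CommutativeRing R renaming (_+_ to _⊕_; _*_ to _⊗_; -_ to ⊖_)
  open Algebra.Properties.Ring ring
  open Algebra.Properties.Semiring.Mult semiring using (×1-homo-*; ×-homo-+) renaming (_×_ to _×′_)
  open Algebra.Properties.CommutativeSemigroup +-commutativeSemigroup using (interchange)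
  open Relation.Binary.Reasoning.Setoid setoid

  -- The integer a − b is represented by the pair (a , b).
  private
    coefficients : RawRing _ _
    coefficients = record
      { Carrier = ℕ × ℕ
      ; _≈_     = _≡_
      ; _+_     = λ (a , b) (c , d) → a + c , b + d
      ; _*_     = λ (a , b) (c , d) → a * c + b * d , a * d + b * c
      ; -_      = λ (a , b) → b , a
      ; 0#      = 0 , 0
      ; 1#      = 1 , 0
      }

    ⟦_⟧ : ℕ × ℕ → Carrier
    ⟦ a , b ⟧ = (a ×′ 1#) - (b ×′ 1#)

    ⟦0,0⟧≈0 : ⟦ 0 , 0 ⟧ ≈ 0#
    ⟦0,0⟧≈0 = -‿inverseʳ 0#

    ⟦1,0⟧≈1 : ⟦ 1 , 0 ⟧ ≈ 1#
    ⟦1,0⟧≈1 = trans (+-cong (+-identityʳ 1#) (trans (sym (+-identityˡ _)) ⟦0,0⟧≈0)) (+-identityʳ 1#)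

    -- Agrees with ⟦_⟧, but makes the constants 0# and 1# definitional.
    ⟦_⟧′ : ℕ × ℕ → Carrier
    ⟦ 0 , 0 ⟧′ = 0#
    ⟦ 1 , 0 ⟧′ = 1#
    ⟦ p ⟧′     = ⟦ p ⟧

    ⟦_⟧′≈ : ∀ p → ⟦ p ⟧′ ≈ ⟦ p ⟧
    ⟦ 0 , 0           ⟧′≈ = sym ⟦0,0⟧≈0
    ⟦ 1 , 0           ⟧′≈ = sym ⟦1,0⟧≈1
    ⟦ suc (suc _) , 0 ⟧′≈ = refl
    ⟦ 0 , suc _       ⟧′≈ = refl
    ⟦ 1 , suc _       ⟧′≈ = refl
    ⟦ suc (suc _) , suc _ ⟧′≈ = refl

    +-−-interchange : ∀ x y z w → (x ⊕ y) - (z ⊕ w) ≈ (x - z) ⊕ (y - w)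
    +-−-interchange x y z w = begin
      (x ⊕ y) - (z ⊕ w)         ≈⟨ +-congˡ (-‿+-comm z w) ⟨
      (x ⊕ y) ⊕ (⊖ z ⊕ ⊖ w)     ≈⟨ interchange x y (⊖ z) (⊖ w) ⟩
      (x - z) ⊕ (y - w)         ∎

    homo-+ : ∀ p q → ⟦ RawRing._+_ coefficients p q ⟧ ≈ ⟦ p ⟧ ⊕ ⟦ q ⟧
    homo-+ (a , b) (c , d) =
      trans (+-cong (×-homo-+ 1# a c) (-‿cong (×-homo-+ 1# b d))) (+-−-interchange _ _ _ _)

    homo-neg : ∀ p → ⟦ RawRing.-_ coefficients p ⟧ ≈ ⊖ ⟦ p ⟧
    homo-neg (a , b) = begin
      (b ×′ 1#) - (a ×′ 1#)         ≈⟨ +-comm _ _ ⟩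
      ⊖ (a ×′ 1#) ⊕ (b ×′ 1#)       ≈⟨ +-congˡ (-‿involutive _) ⟨
      ⊖ (a ×′ 1#) ⊕ ⊖ ⊖ (b ×′ 1#)   ≈⟨ -‿+-comm _ _ ⟩
      ⊖ ((a ×′ 1#) - (b ×′ 1#))     ∎

    *-expand : ∀ x y z w → (x - z) ⊗ (y - w) ≈ (x ⊗ y ⊕ z ⊗ w) - (x ⊗ w ⊕ z ⊗ y)
    *-expand x y z w = begin
      (x - z) ⊗ (y - w)                                   ≈⟨ distribʳ _ _ _ ⟩
      x ⊗ (y - w) ⊕ ⊖ z ⊗ (y - w)                         ≈⟨ +-cong (distribˡ _ _ _) (trans (distribˡ _ _ _) (+-comm _ _)) ⟩
      (x ⊗ y ⊕ x ⊗ ⊖ w) ⊕ (⊖ z ⊗ ⊖ w ⊕ ⊖ z ⊗ y)           ≈⟨ interchange _ _ _ _ ⟩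
      (x ⊗ y ⊕ ⊖ z ⊗ ⊖ w) ⊕ (x ⊗ ⊖ w ⊕ ⊖ z ⊗ y)           ≈⟨ +-cong (+-congˡ neg*neg) (+-cong (sym (-‿distribʳ-* x w)) (sym (-‿distribˡ-* z y))) ⟩
      (x ⊗ y ⊕ z ⊗ w) ⊕ (⊖ (x ⊗ w) ⊕ ⊖ (z ⊗ y))           ≈⟨ +-congˡ (-‿+-comm _ _) ⟩
      (x ⊗ y ⊕ z ⊗ w) - (x ⊗ w ⊕ z ⊗ y)                   ∎
      where
      neg*neg : ⊖ z ⊗ ⊖ w ≈ z ⊗ w
      neg*neg = trans (sym (-‿distribˡ-* z (⊖ w)))
                      (trans (-‿cong (sym (-‿distribʳ-* z w))) (-‿involutive _))

    homo-* : ∀ p q → ⟦ RawRing._*_ coefficients p q ⟧ ≈ ⟦ p ⟧ ⊗ ⟦ q ⟧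
    homo-* (a , b) (c , d) = begin
      ((a * c + b * d) ×′ 1#) - ((a * d + b * c) ×′ 1#)
        ≈⟨ +-cong (split a c b d) (-‿cong (split a d b c)) ⟩
      ((a ×′ 1#) ⊗ (c ×′ 1#) ⊕ (b ×′ 1#) ⊗ (d ×′ 1#)) - ((a ×′ 1#) ⊗ (d ×′ 1#) ⊕ (b ×′ 1#) ⊗ (c ×′ 1#))
        ≈⟨ *-expand _ _ _ _ ⟨
      ⟦ a , b ⟧ ⊗ ⟦ c , d ⟧ ∎
      where
      split : ∀ i j k l → (i * j + k * l) ×′ 1# ≈ (i ×′ 1#) ⊗ (j ×′ 1#) ⊕ (k ×′ 1#) ⊗ (l ×′ 1#)
      split i j k l = trans (×-homo-+ 1# (i * j) (k * l)) (+-cong (×1-homo-* i j) (×1-homo-* k l))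

    almostCommutativeRing : AlmostCommutativeRing c ℓ
    almostCommutativeRing = fromCommutativeRing R

    morphism : coefficients -Raw-AlmostCommutative⟶ almostCommutativeRing
    morphism = record
      { ⟦_⟧    = ⟦_⟧′
      ; +-homo = λ p q → trans ⟦ RawRing._+_ coefficients p q ⟧′≈ (trans (homo-+ p q) (sym (+-cong ⟦ p ⟧′≈ ⟦ q ⟧′≈)))
      ; *-homo = λ p q → trans ⟦ RawRing._*_ coefficients p q ⟧′≈ (trans (homo-* p q) (sym (*-cong ⟦ p ⟧′≈ ⟦ q ⟧′≈)))
      ; -‿homo = λ p → trans ⟦ RawRing.-_ coefficients p ⟧′≈ (trans (homo-neg p) (-‿cong (sym ⟦ p ⟧′≈)))
      ; 0-homo = refl
      ; 1-homo = refl
      }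

    -- Different pairs can represent the same integer, so cross-sums are compared. Adding the zeros
    -- `⟦ d , d ⟧` and `⟦ b , b ⟧` brings the two pairs to a common form.
    _≟′_ : WeaklyDecidable (Induced-equivalence morphism)
    (a , b) ≟′ (c , d) with a + d ℕ.≟ c + b
    ... | no  _  = nothing
    ... | yes eq = just (begin
      ⟦ a , b ⟧′                                     ≈⟨ ⟦ a , b ⟧′≈ ⟩
      ⟦ a , b ⟧                                      ≈⟨ +-identityʳ _ ⟨
      ⟦ a , b ⟧ ⊕ 0#                                 ≈⟨ +-congˡ (-‿inverseʳ (d ×′ 1#)) ⟨
      ⟦ a , b ⟧ ⊕ ⟦ d , d ⟧                          ≈⟨ homo-+ (a , b) (d , d) ⟨
      ⟦ a + d , b + d ⟧                              ≡⟨ ≡.cong₂ (λ i j → ⟦ i , j ⟧) eq (ℕ.+-comm b d) ⟩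
      ⟦ c + b , d + b ⟧                              ≈⟨ homo-+ (c , d) (b , b) ⟩
      ⟦ c , d ⟧ ⊕ ⟦ b , b ⟧                          ≈⟨ +-congˡ (-‿inverseʳ (b ×′ 1#)) ⟩
      ⟦ c , d ⟧ ⊕ 0#                                 ≈⟨ +-identityʳ _ ⟩
      ⟦ c , d ⟧                                      ≈⟨ ⟦ c , d ⟧′≈ ⟨
      ⟦ c , d ⟧′                                     ∎)

  open Algebra.Solver.Ring coefficients almostCommutativeRing morphism _≟′_ public
    using (Polynomial; solve; con; _:=_; _:+_; _:*_; _:-_; :-_)

  :1 : ∀ {n} → Polynomial n
  :1 = con (1 , 0)

  :0 : ∀ {n} → Polynomial n
  :0 = con (0 , 0)

-- The powers of an element q with q ^ M ≈ 0 for some M > 0: in such a ring the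
-- infinite sums and products of q-series theory are finite.
record NilpotentPowers {c ℓ} (R : CommutativeRing c ℓ) (M : ℕ) : Set (c Level.⊔ ℓ) where
  open CommutativeRing R using (Carrier; _≈_; 0#; 1#) renaming (_*_ to _⊗_)
  field
    0<M    : 0 < M
    e      : ℕ → Carrier
    e-zero : e 0 ≈ 1#
    e-+    : ∀ a b → e (a + b) ≈ e a ⊗ e b
    e-≥M   : ∀ {k} → M ≤ k → e k ≈ 0#

-- The series F and its recurrence.

module QSeries {c ℓ} {R : CommutativeRing c ℓ} {M : ℕ} (powers : NilpotentPowers R M) where
  open NilpotentPowers powers public
  open CommutativeRing R public
    using (Carrier; _≈_; 0#; 1#; _-_; refl; sym; trans; reflexive; setoid;
           +-cong; +-congˡ; +-congʳ; +-identityˡ; +-identityʳ; +-comm; -‿cong; -‿inverseʳ;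
           *-cong; *-congˡ; *-congʳ; *-identityˡ; *-identityʳ; *-assoc; zeroˡ; zeroʳ;
           distribˡ; distribʳ; +-commutativeMonoid; *-commutativeMonoid)
    renaming (_+_ to _⊕_; _*_ to _⊗_; -_ to ⊖_)
  open RingSolver R public using (solve; _:=_; _:+_; _:*_; _:-_; :-_; :1; :0)
  open Relation.Binary.Reasoning.Setoid setoid
  open Iteration +-commutativeMonoid public using ()
    renaming ( iterate to ∑; iterate-cong to ∑-cong; iterate-cong< to ∑-cong<; iterate-ε to ∑-zero
             ; iterate-∙ to ∑-⊕; iterate-head to ∑-head)
  open Iteration *-commutativeMonoid public using ()
    renaming ( iterate to ∏; iterate-cong to ∏-cong; iterate-cong< to ∏-cong<; iterate-ε to ∏-one
             ; iterate-∙ to ∏-⊗; iterate-head to ∏-head; iterate-+ to ∏-+; iterate-* to ∏-*)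

  minus-cong : ∀ {x y z w} → x ≈ y → z ≈ w → x - z ≈ y - w
  minus-cong x≈y z≈w = +-cong x≈y (-‿cong z≈w)

  ∑-distribˡ : ∀ n x f → x ⊗ ∑ n f ≈ ∑ n (λ i → x ⊗ f i)
  ∑-distribˡ zero    x f = zeroʳ x
  ∑-distribˡ (suc n) x f = trans (distribˡ x _ _) (+-congʳ (∑-distribˡ n x f))

  ∑-minus : ∀ n f g → ∑ n (λ i → f i - g i) ≈ ∑ n f - ∑ n g
  ∑-minus zero    f g = solve 0 (:0 := :0 :- :0) refl
  ∑-minus (suc n) f g = trans (+-congʳ (∑-minus n f g))
    (solve 4 (λ a b x y → (a :- b) :+ (x :- y) := (a :+ x) :- (b :+ y)) refl (∑ n f) (∑ n g) (f n) (g n))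

  ∑-first : ∀ f → (∀ j → 0 < j → f j ≈ 0#) → ∑ M f ≈ f 0
  ∑-first f f≈0 = begin
    ∑ M f                 ≈⟨ +-identityʳ _ ⟨
    ∑ M f ⊕ 0#            ≈⟨ +-congˡ (f≈0 M 0<M) ⟨
    ∑ (suc M) f           ≈⟨ ∑-head M f ⟩
    f 0 ⊕ ∑ M (f ∘ suc)   ≈⟨ +-congˡ (∑-zero M λ j _ → f≈0 (suc j) z<s) ⟩
    f 0 ⊕ 0#              ≈⟨ +-identityʳ _ ⟩
    f 0                   ∎

  e-cong : ∀ {a b} → a ≡ b → e a ≈ e b
  e-cong = reflexive ∘ ≡.cong e

  e-split : ∀ a b {k} → k ≡ a + b → e k ≈ e a ⊗ e b
  e-split a b k≡a+b = trans (e-cong k≡a+b) (e-+ a b)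

  e-⊗ : ∀ a b c d → a + b ≡ c + d → e a ⊗ e b ≈ e c ⊗ e d
  e-⊗ a b c d eq = trans (sym (e-+ a b)) (e-split c d eq)

  e-≥M-⊗ : ∀ {k} x → M ≤ k → e k ⊗ x ≈ 0#
  e-≥M-⊗ x M≤k = trans (*-congʳ (e-≥M M≤k)) (zeroˡ x)

  1-e≈1 : ∀ {k} → M ≤ k → 1# - e k ≈ 1#
  1-e≈1 M≤k = trans (minus-cong refl (e-≥M M≤k)) (solve 0 (:1 :- :0 := :1) refl)

  1+e≈1 : ∀ {k} → M ≤ k → 1# ⊕ e k ≈ 1#
  1+e≈1 M≤k = trans (+-congˡ (e-≥M M≤k)) (+-identityʳ 1#)

  -- Lets a finite product stand for an infinite one: every cut-off from M on gives the same value.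
  ∏-stable : ∀ {f k} → (∀ i → M ≤ i → f i ≈ 1#) → M ≤ k → ∏ k f ≈ ∏ M f
  ∏-stable {f} {k} f≈1 M≤k = begin
    ∏ k f                                    ≡⟨ ≡.cong (λ i → ∏ i f) (ℕ.m∸n+n≡m M≤k) ⟨
    ∏ (k ∸ M + M) f                          ≈⟨ ∏-+ M (k ∸ M) f ⟩
    ∏ M f ⊗ ∏ (k ∸ M) (λ i → f (i + M))      ≈⟨ *-congˡ (∏-one (k ∸ M) λ i _ → f≈1 (i + M) (ℕ.m≤n+m M i)) ⟩
    ∏ M f ⊗ 1#                               ≈⟨ *-identityʳ _ ⟩
    ∏ M f                                    ∎

  geometric : ℕ → Carrier
  geometric d = ∑ M λ i → e (i * d)

  -- Telescoping leaves 1 - q^(Md), and d ≥ 1 pushes this exponent up to M or beyond.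
  geometric-inverse : ∀ d → .{{NonZero d}} → (1# - e d) ⊗ geometric d ≈ 1#
  geometric-inverse d = begin
    (1# - e d) ⊗ geometric d ≈⟨ partial M ⟩
    1# - e (M * d)           ≈⟨ 1-e≈1 (ℕ.m≤m*n M d) ⟩
    1#                       ∎
    where
    partial : ∀ n → (1# - e d) ⊗ ∑ n (λ i → e (i * d)) ≈ 1# - e (n * d)
    partial zero    = trans (zeroʳ _) (trans (sym (-‿inverseʳ 1#)) (minus-cong refl (sym e-zero)))
    partial (suc n) = begin
      (1# - e d) ⊗ (∑ n (λ i → e (i * d)) ⊕ e (n * d))
        ≈⟨ distribˡ _ _ _ ⟩
      (1# - e d) ⊗ ∑ n (λ i → e (i * d)) ⊕ (1# - e d) ⊗ e (n * d)
        ≈⟨ +-congʳ (partial n) ⟩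
      (1# - e (n * d)) ⊕ (1# - e d) ⊗ e (n * d)
        ≈⟨ solve 2 (λ x y → (:1 :- y) :+ (:1 :- x) :* y := :1 :- x :* y) refl (e d) (e (n * d)) ⟩
      1# - e d ⊗ e (n * d)
        ≈⟨ minus-cong refl (e-+ d (n * d)) ⟨
      1# - e (suc n * d) ∎

  distinctFrom : ℕ → Carrier
  distinctFrom s = ∏ M λ k → 1# ⊕ e (suc (s + k))

  -- Splitting off the first factor would leave only M - 1 others, so a factor equal to 1 is first
  -- appended at the far end.
  distinctFrom-step : ∀ s → distinctFrom s ≈ (1# ⊕ e (suc s)) ⊗ distinctFrom (suc s)
  distinctFrom-step s = begin
    distinctFrom s
      ≈⟨ *-identityʳ _ ⟨
    distinctFrom s ⊗ 1#
      ≈⟨ *-congˡ (1+e≈1 (ℕ.m≤n⇒m≤1+n (ℕ.m≤n+m M s))) ⟨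
    ∏ (suc M) (λ k → 1# ⊕ e (suc (s + k)))
      ≈⟨ ∏-head M (λ k → 1# ⊕ e (suc (s + k))) ⟩
    (1# ⊕ e (suc (s + 0))) ⊗ ∏ M (λ k → 1# ⊕ e (suc (s + suc k)))
      ≈⟨ *-cong (+-congˡ (e-cong (≡.cong suc (ℕ.+-identityʳ s))))
                (∏-cong M λ k → +-congˡ (e-cong (≡.cong suc (ℕ.+-suc s k)))) ⟩
    (1# ⊕ e (suc s)) ⊗ distinctFrom (suc s) ∎

  distinctFrom≈1 : ∀ {s} → M ≤ s → distinctFrom s ≈ 1#
  distinctFrom≈1 {s} M≤s = ∏-one M λ k _ → 1+e≈1 (ℕ.m≤n⇒m≤1+n (ℕ.≤-trans M≤s (ℕ.m≤m+n s k)))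

  evens : ℕ → Carrier
  evens j = ∏ j λ i → geometric (2 * suc i)

  F-term : ℕ → ℕ → Carrier
  F-term m j = e (2 * m * j + 2 * j * j) ⊗ (evens j ⊗ distinctFrom (m + 2 * j))

  F : ℕ → Carrier
  F m = ∑ M (F-term m)

  -- For j > 0 the exponent 2mj + 2j² dominates both m and j. The bound by m gives the limit of `F`;
  -- the bound by j shows that cutting the sum at M loses nothing.
  F-term≈0 : ∀ {m j} → 0 < j → M ≤ m ⊎ M ≤ j → F-term m j ≈ 0#
  F-term≈0 {m} {j} 0<j M≤m⊎M≤j = e-≥M-⊗ _ (bound M≤m⊎M≤j)
    where
    instance
      _ : NonZero j
      _ = >-nonZero 0<j

    bound : M ≤ m ⊎ M ≤ j → M ≤ 2 * m * j + 2 * j * j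
    bound (inj₁ M≤m) = ℕ.≤-trans M≤m (ℕ.≤-trans (ℕ.m≤n*m m 2)
      (ℕ.≤-trans (ℕ.m≤m*n (2 * m) j) (ℕ.m≤m+n _ _)))
    bound (inj₂ M≤j) = ℕ.≤-trans M≤j (ℕ.≤-trans (ℕ.m≤n*m j 2)
      (ℕ.≤-trans (ℕ.m≤m*n (2 * j) j) (ℕ.m≤n+m _ _)))

  F≈1 : ∀ {m} → M ≤ m → F m ≈ 1#
  F≈1 {m} M≤m = trans (∑-first (F-term m) λ j 0<j → F-term≈0 {m} 0<j (inj₁ M≤m)) first
    where
    first : F-term m 0 ≈ 1#
    first = begin
      F-term m 0      ≈⟨ *-cong (trans (e-cong (≡.trans (ℕ.+-identityʳ _) (ℕ.*-zeroʳ (2 * m)))) e-zero)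
                                (trans (*-identityˡ _) (distinctFrom≈1 (ℕ.≤-trans M≤m (ℕ.m≤m+n m 0)))) ⟩
      1# ⊗ 1#         ≈⟨ *-identityˡ 1# ⟩
      1#              ∎

  -- The terms are distributed so that, for `F`, summand j + 1 on the left is exactly summand j on
  -- the right.
  Recurrence : (ℕ → Carrier) → Set ℓ
  Recurrence X = ∀ m →
    X m - (1# ⊕ e (suc m)) ⊗ X (1 + m) ≈ e (2 * suc m) ⊗ X (2 + m) - e (3 * m + 5) ⊗ X (3 + m)

  F-recurrence : Recurrence F
  F-recurrence m = begin
    F m - (1# ⊕ e (suc m)) ⊗ F (1 + m)                 ≈⟨ linear ⟩
    ∑ M left                                           ≈⟨ +-identityʳ _ ⟨
    ∑ M left ⊕ 0#                                      ≈⟨ +-congˡ left-M ⟨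
    ∑ (suc M) left                                     ≈⟨ ∑-head M left ⟩
    left 0 ⊕ ∑ M (left ∘ suc)                          ≈⟨ +-cong left-0 (∑-cong M left-suc) ⟩
    0# ⊕ ∑ M right                                     ≈⟨ +-identityˡ _ ⟩
    ∑ M right                                          ≈⟨ ∑-minus M _ _ ⟩
    _                                                  ≈⟨ minus-cong (∑-distribˡ M _ _) (∑-distribˡ M _ _) ⟨
    e (2 * suc m) ⊗ F (2 + m) - e (3 * m + 5) ⊗ F (3 + m) ∎
    where
    left right : ℕ → Carrier
    left  j = F-term m j - (1# ⊕ e (suc m)) ⊗ F-term (1 + m) j
    right j = e (2 * suc m) ⊗ F-term (2 + m) j - e (3 * m + 5) ⊗ F-term (3 + m) j

    linear : F m - (1# ⊕ e (suc m)) ⊗ F (1 + m) ≈ ∑ M left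
    linear = sym (trans (∑-minus M _ _) (minus-cong refl (sym (∑-distribˡ M _ _))))

    left-M : left M ≈ 0#
    left-M = begin
      left M                              ≈⟨ minus-cong (F-term≈0 {m} 0<M (inj₂ ℕ.≤-refl))
                                               (*-congˡ (F-term≈0 {1 + m} 0<M (inj₂ ℕ.≤-refl))) ⟩
      0# - (1# ⊕ e (suc m)) ⊗ 0#          ≈⟨ solve 1 (λ x → :0 :- x :* :0 := :0) refl _ ⟩
      0#                                  ∎

    left-0 : left 0 ≈ 0#
    left-0 = begin
      left 0
        ≈⟨ minus-cong (*-cong (e≈1 m) (*-congˡ (trans (distinctFrom-step (m + 0)) (*-congʳ (+-congˡ (e-cong (≡.cong suc (ℕ.+-identityʳ m))))))))
                      (*-congˡ (*-congʳ (e≈1 (suc m)))) ⟩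
      1# ⊗ (1# ⊗ ((1# ⊕ e (suc m)) ⊗ P)) - (1# ⊕ e (suc m)) ⊗ (1# ⊗ (1# ⊗ P))
        ≈⟨ solve 2 (λ x p → :1 :* (:1 :* ((:1 :+ x) :* p)) :- (:1 :+ x) :* (:1 :* (:1 :* p)) := :0) refl (e (suc m)) P ⟩
      0# ∎
      where
      P = distinctFrom (suc m + 0)
      e≈1 : ∀ k → e (2 * k * 0 + 2 * 0 * 0) ≈ 1#
      e≈1 k = trans (e-cong (≡.trans (ℕ.+-identityʳ _) (ℕ.*-zeroʳ (2 * k)))) e-zero

    -- With y = q^(m+1) and u = q^(2(j+1)), the left side contains (1 + yu) - (1 + y)u = 1 - u,
    -- which cancels the last factor of `evens (suc j)`. Writing the remaining 1 as (1 + yu) - yu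
    -- then produces the summands of F(m+2) and F(m+3).
    left-suc : ∀ j → left (suc j) ≈ right j
    left-suc j = begin
      left (suc j)
        ≈⟨ minus-cong (*-congˡ (*-congˡ P-step)) (*-congˡ (*-congʳ (e-split a (2 * suc j) (eq₁ m j)))) ⟩
      e a ⊗ ((evens j ⊗ g) ⊗ ((1# ⊕ y ⊗ u) ⊗ P)) - (1# ⊕ y) ⊗ ((e a ⊗ u) ⊗ ((evens j ⊗ g) ⊗ P))
        ≈⟨ solve 6 (λ A I g y u P → A :* ((I :* g) :* ((:1 :+ y :* u) :* P)) :- (:1 :+ y) :* ((A :* u) :* ((I :* g) :* P))
                                    := A :* (I :* P) :* ((:1 :- u) :* g)) refl (e a) (evens j) g y u P ⟩
      e a ⊗ (evens j ⊗ P) ⊗ ((1# - u) ⊗ g)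
        ≈⟨ *-congˡ (geometric-inverse (2 * suc j)) ⟩
      e a ⊗ (evens j ⊗ P) ⊗ 1#
        ≈⟨ solve 5 (λ A I P y u → A :* (I :* P) :* :1
                       := A :* (I :* ((:1 :+ y :* u) :* P)) :- (A :* (y :* u)) :* (I :* P)) refl (e a) (evens j) P y u ⟩
      e a ⊗ (evens j ⊗ ((1# ⊕ y ⊗ u) ⊗ P)) - (e a ⊗ (y ⊗ u)) ⊗ (evens j ⊗ P)
        ≈⟨ minus-cong
             (*-cong (sym (e-split (2 * suc m) (2 * (2 + m) * j + 2 * j * j) (eq₂ m j)))
                     (*-congˡ (trans (reflexive (≡.cong distinctFrom (eq₃ m j))) P-step)))
             (*-cong (trans (e-⊗ (3 * m + 5) _ a _ (eq₄ m j)) (*-congˡ (e-+ (suc m) (2 * suc j))))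
                     (*-congˡ (reflexive (≡.cong (distinctFrom ∘ suc) (eq₃ m j))))) ⟨
      (e (2 * suc m) ⊗ e (2 * (2 + m) * j + 2 * j * j)) ⊗ (evens j ⊗ distinctFrom (2 + m + 2 * j))
        - (e (3 * m + 5) ⊗ e (2 * (3 + m) * j + 2 * j * j)) ⊗ (evens j ⊗ distinctFrom (3 + m + 2 * j))
        ≈⟨ minus-cong (*-assoc _ _ _) (*-assoc _ _ _) ⟩
      right j ∎
      where
      a = 2 * m * suc j + 2 * suc j * suc j
      g = geometric (2 * suc j)
      u = e (2 * suc j)
      y = e (suc m)
      P = distinctFrom (suc m + 2 * suc j)
      P-step : distinctFrom (m + 2 * suc j) ≈ (1# ⊕ y ⊗ u) ⊗ P
      P-step = trans (distinctFrom-step (m + 2 * suc j)) (*-congʳ (+-congˡ (e-+ (suc m) (2 * suc j))))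

      eq₁ : ∀ m j → 2 * (1 + m) * suc j + 2 * suc j * suc j ≡ (2 * m * suc j + 2 * suc j * suc j) + 2 * suc j
      eq₁ = solve-∀
      eq₂ : ∀ m j → 2 * m * suc j + 2 * suc j * suc j ≡ 2 * suc m + (2 * (2 + m) * j + 2 * j * j)
      eq₂ = solve-∀
      eq₃ : ∀ m j → 2 + m + 2 * j ≡ m + 2 * suc j
      eq₃ = solve-∀
      eq₄ : ∀ m j → (3 * m + 5) + (2 * (3 + m) * j + 2 * j * j) ≡ (2 * m * suc j + 2 * suc j * suc j) + (suc m + 2 * suc j)
      eq₄ = solve-∀

-- The Rogers-Selberg sum G, its recurrence and the identity G = E F.

module RogersSelberg {c ℓ} {R : CommutativeRing c ℓ} {M : ℕ} (powers : NilpotentPowers R M) where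
  open QSeries powers public
  open Relation.Binary.Reasoning.Setoid setoid

  -- α n = (−1)^n q^(n(7n+1)/2)
  α : ℕ → Carrier
  α zero    = 1#
  α (suc n) = ⊖ (α n ⊗ e (7 * n + 4))

  M≤7n+4 : ∀ {n} → M ≤ suc n → M ≤ 7 * n + 4
  M≤7n+4 {n} M≤1+n = ℕ.≤-trans M≤1+n
    (≡.subst (_≤ 7 * n + 4) (ℕ.+-comm n 1) (ℕ.+-mono-≤ (ℕ.m≤n*m n 7) (s≤s z≤n)))

  α≈0 : ∀ {n} → M ≤ n → α n ≈ 0#
  α≈0 {zero}  M≤0   with () ← ℕ.<-≤-trans 0<M M≤0
  α≈0 {suc n} M≤1+n = begin
    ⊖ (α n ⊗ e (7 * n + 4))   ≈⟨ -‿cong (*-congˡ (e-≥M (M≤7n+4 M≤1+n))) ⟩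
    ⊖ (α n ⊗ 0#)              ≈⟨ solve 1 (λ x → :- (x :* :0) := :0) refl (α n) ⟩
    0#                        ∎

  -- Equal to (q)_(m+n) / (q)_n, that is, (q)_m times the quotient (q^(m+1))_n / (q)_n of Selberg's
  -- function.
  h : ℕ → ℕ → Carrier
  h m n = ∏ m λ j → 1# - e (suc (n + j))

  h-head : ∀ m n → h (suc m) n ≈ (1# - e (suc n)) ⊗ h m (suc n)
  h-head m n = trans (∏-head m _)
    (*-cong (minus-cong refl (e-cong (≡.cong suc (ℕ.+-identityʳ n))))
            (∏-cong m λ j → minus-cong refl (e-cong (≡.cong suc (ℕ.+-suc n j)))))

  -- Selberg's family, meant for i + b = 3: the bracket is then q^(3mn + bn) (1 - q^(i(m+2n+1))).
  -- Carrying b separately avoids the subtraction 3 - i.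
  K-term : ℕ → ℕ → ℕ → ℕ → Carrier
  K-term i b m n = α n ⊗ (h m n ⊗ (e (3 * m * n + b * n) - e (3 * m * n + 3 * n + i * suc (n + m))))

  K : ℕ → ℕ → ℕ → Carrier
  K i b m = ∑ M (K-term i b m)

  -- In the difference of the two members at m, the second exponentials contribute 1 - q^(n+m+1),
  -- which extends `h m n` to `h (suc m) n` and gives `L`; the first contribute 1 - q^n and give
  -- `U`. Since `U 0` vanishes, `U` may be shifted by one, and then (1 - q^(n+1)) `h m (suc n)` is
  -- again `h (suc m) n`, so that `L` and the shifted `U` combine into a summand at m + 1.
  K-step : ∀ a b m → a + b ≡ 2 → K (suc a) b m ≈ K a (suc b) m ⊕ e (a * suc m) ⊗ K (suc b) a (suc m)
  K-step a b m a+b≡2 = begin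
    K (suc a) b m                                        ≈⟨ solve 2 (λ x y → x := y :+ (x :- y)) refl _ _ ⟩
    K a (suc b) m ⊕ (K (suc a) b m - K a (suc b) m)      ≈⟨ +-congˡ (∑-minus M _ _) ⟨
    K a (suc b) m ⊕ ∑ M (λ n → K-term (suc a) b m n - K-term a (suc b) m n)
                                                         ≈⟨ +-congˡ (∑-cong M difference) ⟩
    K a (suc b) m ⊕ ∑ M (λ n → L n ⊕ U n)                ≈⟨ +-congˡ (∑-⊕ M L U) ⟩
    K a (suc b) m ⊕ (∑ M L ⊕ ∑ M U)                      ≈⟨ +-congˡ (+-congˡ shift) ⟩
    K a (suc b) m ⊕ (∑ M L ⊕ ∑ M (U ∘ suc))              ≈⟨ +-congˡ (∑-⊕ M L (U ∘ suc)) ⟨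
    K a (suc b) m ⊕ ∑ M (λ n → L n ⊕ U (suc n))          ≈⟨ +-congˡ (∑-cong M recombine) ⟨
    K a (suc b) m ⊕ ∑ M (λ n → e (a * suc m) ⊗ K-term (suc b) a (suc m) n)
                                                         ≈⟨ +-congˡ (∑-distribˡ M _ _) ⟨
    K a (suc b) m ⊕ e (a * suc m) ⊗ K (suc b) a (suc m)  ∎
    where
    L U : ℕ → Carrier
    L n = α n ⊗ (h (suc m) n ⊗ e (3 * m * n + 3 * n + a * suc (n + m)))
    U n = α n ⊗ (h m n ⊗ ((1# - e n) ⊗ e (3 * m * n + b * n)))

    shift : ∑ M U ≈ ∑ M (U ∘ suc)
    shift = begin
      ∑ M U                     ≈⟨ +-identityʳ _ ⟨
      ∑ M U ⊕ 0#                ≈⟨ +-congˡ (trans (*-congʳ (α≈0 ℕ.≤-refl)) (zeroˡ _)) ⟨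
      ∑ (suc M) U               ≈⟨ ∑-head M U ⟩
      U 0 ⊕ ∑ M (U ∘ suc)       ≈⟨ +-congʳ (*-congˡ (*-congˡ (*-congʳ (minus-cong refl e-zero)))) ⟩
      _                         ≈⟨ solve 4 (λ x y z s → x :* (y :* ((:1 :- :1) :* z)) :+ s := s) refl _ _ _ _ ⟩
      ∑ M (U ∘ suc)             ∎

    difference : ∀ n → K-term (suc a) b m n - K-term a (suc b) m n ≈ L n ⊕ U n
    difference n = begin
      K-term (suc a) b m n - K-term a (suc b) m n
        ≈⟨ minus-cong (*-congˡ (*-congˡ (minus-cong refl (e-split r (suc (n + m)) (eq₁ a m n)))))
                      (*-congˡ (*-congˡ (minus-cong (e-split p n (eq₂ b m n)) refl))) ⟩
      α n ⊗ (h m n ⊗ (e p - e r ⊗ e (suc (n + m)))) - α n ⊗ (h m n ⊗ (e p ⊗ e n - e r))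
        ≈⟨ solve 6 (λ A H P Q Z U → A :* (H :* (P :- Q :* Z)) :- A :* (H :* (P :* U :- Q))
                                 := A :* ((H :* (:1 :- Z)) :* Q) :+ A :* (H :* ((:1 :- U) :* P)))
                 refl (α n) (h m n) (e p) (e r) (e (suc (n + m))) (e n) ⟩
      L n ⊕ U n ∎
      where
      p = 3 * m * n + b * n
      r = 3 * m * n + 3 * n + a * suc (n + m)
      eq₁ : ∀ a m n → 3 * m * n + 3 * n + suc a * suc (n + m) ≡ (3 * m * n + 3 * n + a * suc (n + m)) + suc (n + m)
      eq₁ = solve-∀
      eq₂ : ∀ b m n → 3 * m * n + suc b * n ≡ (3 * m * n + b * n) + n
      eq₂ = solve-∀

    recombine : ∀ n → e (a * suc m) ⊗ K-term (suc b) a (suc m) n ≈ L n ⊕ U (suc n)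
    recombine n = begin
      e (a * suc m) ⊗ (α n ⊗ (h (suc m) n ⊗ (e p - e r)))
        ≈⟨ solve 5 (λ E A H P Q → E :* (A :* (H :* (P :- Q))) := A :* (H :* (E :* P)) :- (A :* H) :* (E :* Q))
                 refl (e (a * suc m)) (α n) (h (suc m) n) (e p) (e r) ⟩
      α n ⊗ (h (suc m) n ⊗ (e (a * suc m) ⊗ e p)) - (α n ⊗ h (suc m) n) ⊗ (e (a * suc m) ⊗ e r)
        ≈⟨ minus-cong (*-congˡ (*-congˡ (sym (e-split (a * suc m) p (eq₁ a m n)))))
                      (*-cong (*-congˡ (h-head m n)) (e-⊗ (a * suc m) r (7 * n + 4) s (eq₂ a b a+b≡2 m n))) ⟩
      L n - (α n ⊗ ((1# - e (suc n)) ⊗ h m (suc n))) ⊗ (e (7 * n + 4) ⊗ e s)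
        ≈⟨ solve 6 (λ l A U H W S → l :- (A :* ((:1 :- U) :* H)) :* (W :* S) := l :+ (:- (A :* W)) :* (H :* ((:1 :- U) :* S)))
                 refl (L n) (α n) (e (suc n)) (h m (suc n)) (e (7 * n + 4)) (e s) ⟩
      L n ⊕ U (suc n) ∎
      where
      p = 3 * suc m * n + a * n
      r = 3 * suc m * n + 3 * n + suc b * suc (n + suc m)
      s = 3 * m * suc n + b * suc n
      eq₁ : ∀ a m n → 3 * m * n + 3 * n + a * suc (n + m) ≡ a * suc m + (3 * suc m * n + a * n)
      eq₁ = solve-∀
      eq₂₀ : ∀ m n → 0 * suc m + (3 * suc m * n + 3 * n + 3 * suc (n + suc m)) ≡ (7 * n + 4) + (3 * m * suc n + 2 * suc n)
      eq₂₀ = solve-∀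
      eq₂₁ : ∀ m n → 1 * suc m + (3 * suc m * n + 3 * n + 2 * suc (n + suc m)) ≡ (7 * n + 4) + (3 * m * suc n + 1 * suc n)
      eq₂₁ = solve-∀
      eq₂₂ : ∀ m n → 2 * suc m + (3 * suc m * n + 3 * n + 1 * suc (n + suc m)) ≡ (7 * n + 4) + (3 * m * suc n + 0 * suc n)
      eq₂₂ = solve-∀
      eq₂ : ∀ a b → a + b ≡ 2 → ∀ m n → a * suc m + (3 * suc m * n + 3 * n + suc b * suc (n + suc m))
                                      ≡ (7 * n + 4) + (3 * m * suc n + b * suc n)
      -- The exponents agree only because a + b = 2; fixing the three possible pairs leaves
      -- polynomial identities in m and n.
      eq₂ 0 _ ≡.refl = eq₂₀
      eq₂ 1 _ ≡.refl = eq₂₁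
      eq₂ 2 _ ≡.refl = eq₂₂

  -- For i = 0 the factor 1 - q^(i(m+2n+1)) is zero; this closes the chain of `K-step`.
  K₀₃≈0 : ∀ m → K 0 3 m ≈ 0#
  K₀₃≈0 m = ∑-zero M λ n _ → cancel n (3 * m * n + 3 * n)
    where
    cancel : ∀ n x → α n ⊗ (h m n ⊗ (e x - e (x + 0))) ≈ 0#
    cancel n x = begin
      α n ⊗ (h m n ⊗ (e x - e (x + 0)))  ≈⟨ *-congˡ (*-congˡ (minus-cong refl (e-cong (ℕ.+-identityʳ x)))) ⟩
      α n ⊗ (h m n ⊗ (e x - e x))        ≈⟨ solve 3 (λ a b c → a :* (b :* (c :- c)) := :0) refl _ _ _ ⟩
      0#                                 ∎

  G : ℕ → Carrier
  G = K 3 0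

  -- Three instances of `K-step` suffice. The last gives K₁₂(k) = G(k+1), the first then K₂₁(k) =
  -- G(k) - q^(2(k+1)) G(k+2), and substituting both in the middle one eliminates everything but
  -- `G`. The exponent 3m + 5 is (m + 1) + 2(m + 2).
  G-recurrence : Recurrence G
  G-recurrence m = begin
    G m - (1# ⊕ y) ⊗ G (1 + m)
      ≈⟨ minus-cong (K-step 2 0 m ≡.refl) refl ⟩
    (K 2 1 m ⊕ z ⊗ K 1 2 (1 + m)) - (1# ⊕ y) ⊗ G (1 + m)
      ≈⟨ minus-cong (+-cong (K-step 1 1 m ≡.refl) (*-congˡ (K₁₂≈G (1 + m)))) refl ⟩
    ((K 1 2 m ⊕ e (1 * suc m) ⊗ K 2 1 (1 + m)) ⊕ z ⊗ G (2 + m)) - (1# ⊕ y) ⊗ G (1 + m)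
      ≈⟨ minus-cong (+-congʳ (+-cong (K₁₂≈G m) (*-cong (e-cong (ℕ.+-identityʳ (suc m))) (K₂₁≈ (1 + m))))) refl ⟩
    ((G (1 + m) ⊕ y ⊗ (G (1 + m) - w ⊗ G (3 + m))) ⊕ z ⊗ G (2 + m)) - (1# ⊕ y) ⊗ G (1 + m)
      ≈⟨ solve 6 (λ y z w a b c → ((a :+ y :* (a :- w :* c)) :+ z :* b) :- (:1 :+ y) :* a := z :* b :- (y :* w) :* c)
               refl y z w (G (1 + m)) (G (2 + m)) (G (3 + m)) ⟩
    z ⊗ G (2 + m) - (y ⊗ w) ⊗ G (3 + m)
      ≈⟨ minus-cong refl (*-congʳ (e-split (suc m) (2 * suc (1 + m)) (eq m))) ⟨
    z ⊗ G (2 + m) - e (3 * m + 5) ⊗ G (3 + m) ∎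
    where
    y = e (suc m)
    z = e (2 * suc m)
    w = e (2 * suc (1 + m))

    eq : ∀ m → 3 * m + 5 ≡ suc m + 2 * suc (1 + m)
    eq = solve-∀

    K₁₂≈G : ∀ k → K 1 2 k ≈ G (suc k)
    K₁₂≈G k = begin
      K 1 2 k                   ≈⟨ K-step 0 2 k ≡.refl ⟩
      K 0 3 k ⊕ e 0 ⊗ G (suc k) ≈⟨ +-cong (K₀₃≈0 k) (*-congʳ e-zero) ⟩
      0# ⊕ 1# ⊗ G (suc k)       ≈⟨ trans (+-identityˡ _) (*-identityˡ _) ⟩
      G (suc k)                 ∎

    K₂₁≈ : ∀ k → K 2 1 k ≈ G k - e (2 * suc k) ⊗ G (2 + k)
    K₂₁≈ k = begin
      K 2 1 k
        ≈⟨ solve 2 (λ x y → x := (x :+ y) :- y) refl _ _ ⟩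
      (K 2 1 k ⊕ e (2 * suc k) ⊗ G (2 + k)) - e (2 * suc k) ⊗ G (2 + k)
        ≈⟨ minus-cong (trans (K-step 2 0 k ≡.refl) (+-congˡ (*-congˡ (K₁₂≈G (1 + k))))) refl ⟨
      G k - e (2 * suc k) ⊗ G (2 + k) ∎

  -- Downward induction on m, with k bounding the distance to M: each value is determined by the
  -- next three.
  Recurrence-unique : ∀ {X Y} → Recurrence X → Recurrence Y → (∀ {m} → M ≤ m → X m ≈ Y m) → ∀ m → X m ≈ Y m
  Recurrence-unique {X} {Y} recX recY X≈Y m = descend M m (ℕ.m≤m+n M m)
    where
    unfold : ∀ {Z} → Recurrence Z → ∀ m →
      Z m ≈ (1# ⊕ e (suc m)) ⊗ Z (1 + m) ⊕ (e (2 * suc m) ⊗ Z (2 + m) - e (3 * m + 5) ⊗ Z (3 + m))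
    unfold recZ m = trans (solve 2 (λ x y → x := y :+ (x :- y)) refl _ _) (+-congˡ (recZ m))

    descend : ∀ k m → M ≤ k + m → X m ≈ Y m
    descend zero    m M≤m   = X≈Y M≤m
    descend (suc k) m M≤k+m = begin
      X m ≈⟨ unfold recX m ⟩
      _   ≈⟨ +-cong (*-congˡ (ih 0)) (minus-cong (*-congˡ (ih 1)) (*-congˡ (ih 2))) ⟩
      _   ≈⟨ unfold recY m ⟨
      Y m ∎
      where
      ih : ∀ i → X (i + suc m) ≈ Y (i + suc m)
      ih i = descend k (i + suc m) (ℕ.≤-trans M≤k+m
        (≡.subst (_≤ k + (i + suc m)) (ℕ.+-suc k m) (ℕ.+-monoʳ-≤ k (ℕ.m≤n+m (suc m) i))))

  euler : Carrier
  euler = h M 0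

  h₀-stable : ∀ {m} → M ≤ m → h m 0 ≈ euler
  h₀-stable = ∏-stable λ j M≤j → 1-e≈1 (ℕ.m≤n⇒m≤1+n M≤j)

  -- Every summand with n > 0 carries q^(3mn), which is zero here; the summand n = 0 is `h m 0`
  -- alone.
  G≈euler : ∀ {m} → M ≤ m → G m ≈ euler
  G≈euler {m} M≤m = begin
    G m
      ≈⟨ ∑-first (K-term 3 0 m) (λ j 0<j → vanish j {{>-nonZero 0<j}}) ⟩
    1# ⊗ (h m 0 ⊗ (e (3 * m * 0 + 0) - e (3 * m * 0 + 0 + 3 * suc m)))
      ≈⟨ *-congˡ (*-cong (h₀-stable M≤m) (minus-cong (trans (e-cong (≡.trans (ℕ.+-identityʳ _) (ℕ.*-zeroʳ (3 * m)))) e-zero)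
           (e-≥M (ℕ.≤-trans M≤m (ℕ.≤-trans (ℕ.n≤1+n m) (ℕ.≤-trans (ℕ.m≤n*m (suc m) 3) (ℕ.m≤n+m _ _))))))) ⟩
    1# ⊗ (euler ⊗ (1# - 0#))
      ≈⟨ solve 1 (λ x → :1 :* (x :* (:1 :- :0)) := x) refl euler ⟩
    euler ∎
    where
    vanish : ∀ j → .{{NonZero j}} → K-term 3 0 m j ≈ 0#
    vanish j = begin
      K-term 3 0 m j               ≈⟨ *-congˡ (*-congˡ (minus-cong (e-≥M (ℕ.≤-trans M≤3mj (ℕ.m≤m+n _ _)))
                                                                   (e-≥M (ℕ.≤-trans M≤3mj (ℕ.≤-trans (ℕ.m≤m+n _ _) (ℕ.m≤m+n _ _)))))) ⟩
      α j ⊗ (h m j ⊗ (0# - 0#))    ≈⟨ solve 2 (λ x y → x :* (y :* (:0 :- :0)) := :0) refl _ _ ⟩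
      0#                           ∎
      where
      M≤3mj : M ≤ 3 * m * j
      M≤3mj = ℕ.≤-trans M≤m (ℕ.≤-trans (ℕ.m≤n*m m 3) (ℕ.m≤m*n (3 * m) j))

  G≈euler⊗F : ∀ m → G m ≈ euler ⊗ F m
  G≈euler⊗F = Recurrence-unique G-recurrence scaled
    (λ M≤m → trans (G≈euler M≤m) (trans (sym (*-identityʳ euler)) (*-congˡ (sym (F≈1 M≤m)))))
    where
    scaled : Recurrence (λ m → euler ⊗ F m)
    scaled m = begin
      euler ⊗ F m - (1# ⊕ e (suc m)) ⊗ (euler ⊗ F (1 + m))
        ≈⟨ solve 4 (λ c x y z → c :* x :- y :* (c :* z) := c :* (x :- y :* z)) refl _ _ _ _ ⟩
      euler ⊗ (F m - (1# ⊕ e (suc m)) ⊗ F (1 + m))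
        ≈⟨ *-congˡ (F-recurrence m) ⟩
      euler ⊗ (e (2 * suc m) ⊗ F (2 + m) - e (3 * m + 5) ⊗ F (3 + m))
        ≈⟨ solve 5 (λ c x y z w → c :* (x :* y :- z :* w) := x :* (c :* y) :- z :* (c :* w)) refl _ _ _ _ _ ⟩
      e (2 * suc m) ⊗ (euler ⊗ F (2 + m)) - e (3 * m + 5) ⊗ (euler ⊗ F (3 + m)) ∎

  -- The two-sided theta series with terms (-1)^n q^(n(7n+1)/2), n in ℤ, after pairing the indices n
  -- and -n - 1.
  θ : Carrier
  θ = ∑ M λ n → α n ⊗ (1# - e (6 * n + 3))

  G₀≈θ : G 0 ≈ θ
  G₀≈θ = ∑-cong M λ n → *-congˡ (trans (*-identityˡ _) (minus-cong e-zero (e-cong (eq n))))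
    where
    eq : ∀ n → 3 * n + 3 * suc (n + 0) ≡ 6 * n + 3
    eq = solve-∀

admissible : ℕ → Bool
admissible 0 = false
admissible 3 = false
admissible 4 = false
admissible _ = true

-- Jacobi's triple product in base q^7, from its finite form.

module TripleProduct {c ℓ} {R : CommutativeRing c ℓ} {M : ℕ} (powers : NilpotentPowers R M) where
  open RogersSelberg powers public
  open Relation.Binary.Reasoning.Setoid setoid

  -- β n is the term of index −n − 1 of the two-sided sequence that extends α.
  β : ℕ → Carrier
  β n = ⊖ (α n ⊗ e (6 * n + 3))

  β-suc : ∀ n → β (suc n) ≈ ⊖ (β n ⊗ e (7 * n + 10))
  β-suc n = begin
    ⊖ ((⊖ (α n ⊗ e (7 * n + 4))) ⊗ e (6 * suc n + 3))
      ≈⟨ solve 3 (λ a x y → :- ((:- (a :* x)) :* y) := a :* (x :* y)) refl _ _ _ ⟩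
    α n ⊗ (e (7 * n + 4) ⊗ e (6 * suc n + 3))
      ≈⟨ *-congˡ (e-⊗ (7 * n + 4) (6 * suc n + 3) (6 * n + 3) (7 * n + 10) (eq n)) ⟩
    α n ⊗ (e (6 * n + 3) ⊗ e (7 * n + 10))
      ≈⟨ solve 3 (λ a x y → a :* (x :* y) := :- ((:- (a :* x)) :* y)) refl _ _ _ ⟩
    ⊖ (β n ⊗ e (7 * n + 10)) ∎
    where
    eq : ∀ n → (7 * n + 4) + (6 * suc n + 3) ≡ (6 * n + 3) + (7 * n + 10)
    eq = solve-∀

  β≈0 : ∀ {n} → M ≤ n → β n ≈ 0#
  β≈0 M≤n = trans (-‿cong (*-congʳ (α≈0 M≤n))) (solve 1 (λ x → :- (:0 :* x) := :0) refl _)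

  -- With Q = q^7: poch k = (1 − Q) ⋯ (1 − Q^k), r k = 1 / poch k and
  -- ρ N n = r (N − n), understood as 0 when n > N.
  poch r : ℕ → Carrier
  poch k = ∏ k λ i → 1# - e (7 * suc i)
  r    k = ∏ k λ i → geometric (7 * suc i)

  ρ : ℕ → ℕ → Carrier
  ρ N       zero    = r N
  ρ zero    (suc n) = 0#
  ρ (suc N) (suc n) = ρ N n

  r-suc : ∀ k → r k ≈ (1# - e (7 * suc k)) ⊗ r (suc k)
  r-suc k = sym (begin
    (1# - e (7 * suc k)) ⊗ (r k ⊗ geometric (7 * suc k))
      ≈⟨ solve 3 (λ x y z → x :* (y :* z) := y :* (x :* z)) refl _ _ _ ⟩
    r k ⊗ ((1# - e (7 * suc k)) ⊗ geometric (7 * suc k))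
      ≈⟨ *-congˡ (geometric-inverse (7 * suc k)) ⟩
    r k ⊗ 1#
      ≈⟨ *-identityʳ _ ⟩
    r k ∎)

  poch⊗r : ∀ k → poch k ⊗ r k ≈ 1#
  poch⊗r k = trans (sym (∏-⊗ k _ _)) (∏-one k λ i _ → geometric-inverse (7 * suc i))

  -- A q-Pascal rule divided by q-factorials: with u = Q^(N-n) and v = Q^(b+1), it is 1 - uv = (1 -
  -- v) + v(1 - u). The hypothesis says s + 1 = (N - n) + (b + 1) without subtraction, and for n > N
  -- both sides vanish.
  pascal₁ : ∀ N n b s → n + s ≡ N + b →
    (1# - e (7 * suc s)) ⊗ (ρ N n ⊗ r (suc b)) ≈ ρ N n ⊗ r b ⊕ e (7 * suc b) ⊗ (ρ N (suc n) ⊗ r (suc b))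
  pascal₁ zero zero b .b ≡.refl = begin
    (1# - v) ⊗ (1# ⊗ r (suc b))               ≈⟨ solve 2 (λ v x → (:1 :- v) :* (:1 :* x) := :1 :* ((:1 :- v) :* x) :+ v :* (:0 :* x)) refl v _ ⟩
    1# ⊗ ((1# - v) ⊗ r (suc b)) ⊕ v ⊗ (0# ⊗ r (suc b)) ≈⟨ +-congʳ (*-congˡ (r-suc b)) ⟨
    1# ⊗ r b ⊕ v ⊗ (0# ⊗ r (suc b))           ∎
    where v = e (7 * suc b)
  pascal₁ (suc N) zero b .(suc N + b) ≡.refl = begin
    (1# - e (7 * suc (suc N + b))) ⊗ (r (suc N) ⊗ r (suc b))
      ≈⟨ *-congʳ (minus-cong refl (e-split (7 * suc N) (7 * suc b) (eq N b))) ⟩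
    (1# - u ⊗ v) ⊗ (r (suc N) ⊗ r (suc b))
      ≈⟨ solve 4 (λ u v x y → (:1 :- u :* v) :* (x :* y) := x :* ((:1 :- v) :* y) :+ v :* (((:1 :- u) :* x) :* y)) refl u v _ _ ⟩
    r (suc N) ⊗ ((1# - v) ⊗ r (suc b)) ⊕ v ⊗ (((1# - u) ⊗ r (suc N)) ⊗ r (suc b))
      ≈⟨ +-cong (*-congˡ (r-suc b)) (*-congˡ (*-congʳ (r-suc N))) ⟨
    r (suc N) ⊗ r b ⊕ v ⊗ (r N ⊗ r (suc b)) ∎
    where
    u = e (7 * suc N)
    v = e (7 * suc b)
    eq : ∀ N b → 7 * suc (suc N + b) ≡ 7 * suc N + 7 * suc b
    eq = solve-∀
  pascal₁ zero (suc n) b s eq =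
    solve 4 (λ s x y v → (:1 :- s) :* (:0 :* x) := :0 :* y :+ v :* (:0 :* x)) refl (e (7 * suc s)) (r (suc b)) (r b) (e (7 * suc b))
  pascal₁ (suc N) (suc n) b s eq = pascal₁ N n b s (ℕ.suc-injective eq)

  -- The companion rule, from 1 - uv = (1 - u) + u(1 - v). It is `pascal₁` as seen after the
  -- reflection n to -n - 1, which exchanges the two denominators.
  pascal₂ : ∀ N n b s → n + s ≡ N + b →
    (1# - e (7 * suc s)) ⊗ (ρ N n ⊗ r (suc b)) ≈ ρ N (suc n) ⊗ r (suc b) ⊕ e (7 * (N ∸ n)) ⊗ (ρ N n ⊗ r b)
  pascal₂ zero zero b .b ≡.refl = begin
    (1# - v) ⊗ (1# ⊗ r (suc b))                        ≈⟨ solve 2 (λ v x → (:1 :- v) :* (:1 :* x) := :0 :* x :+ :1 :* (:1 :* ((:1 :- v) :* x))) refl v _ ⟩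
    0# ⊗ r (suc b) ⊕ 1# ⊗ (1# ⊗ ((1# - v) ⊗ r (suc b))) ≈⟨ +-congˡ (*-cong e-zero (*-congˡ (r-suc b))) ⟨
    0# ⊗ r (suc b) ⊕ e 0 ⊗ (1# ⊗ r b)                  ∎
    where v = e (7 * suc b)
  pascal₂ (suc N) zero b .(suc N + b) ≡.refl = begin
    (1# - e (7 * suc (suc N + b))) ⊗ (r (suc N) ⊗ r (suc b))
      ≈⟨ *-congʳ (minus-cong refl (e-split (7 * suc N) (7 * suc b) (eq N b))) ⟩
    (1# - u ⊗ v) ⊗ (r (suc N) ⊗ r (suc b))
      ≈⟨ solve 4 (λ u v x y → (:1 :- u :* v) :* (x :* y) := ((:1 :- u) :* x) :* y :+ u :* (x :* ((:1 :- v) :* y))) refl u v _ _ ⟩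
    ((1# - u) ⊗ r (suc N)) ⊗ r (suc b) ⊕ u ⊗ (r (suc N) ⊗ ((1# - v) ⊗ r (suc b)))
      ≈⟨ +-cong (*-congʳ (r-suc N)) (*-congˡ (*-congˡ (r-suc b))) ⟨
    r N ⊗ r (suc b) ⊕ u ⊗ (r (suc N) ⊗ r b) ∎
    where
    u = e (7 * suc N)
    v = e (7 * suc b)
    eq : ∀ N b → 7 * suc (suc N + b) ≡ 7 * suc N + 7 * suc b
    eq = solve-∀
  pascal₂ zero (suc n) b s eq =
    solve 4 (λ s x y v → (:1 :- s) :* (:0 :* x) := :0 :* x :+ v :* (:0 :* y)) refl (e (7 * suc s)) (r (suc b)) (r b) (e 0)
  pascal₂ (suc N) (suc n) b s eq = pascal₂ N n b s (ℕ.suc-injective eq)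

  -- Truncated subtraction is harmless next to ρ N n, which vanishes for n > N.
  e-∸-ρ : ∀ N n → e (7 * (N ∸ n)) ⊗ (e (7 * n) ⊗ ρ N n) ≈ e (7 * N) ⊗ ρ N n
  e-∸-ρ N       zero    = *-congˡ (trans (*-congʳ e-zero) (*-identityˡ _))
  e-∸-ρ zero    (suc n) = solve 3 (λ x y z → x :* (y :* :0) := z :* :0) refl _ _ _
  e-∸-ρ (suc N) (suc n) = begin
    e (7 * (N ∸ n)) ⊗ (e (7 * suc n) ⊗ ρ N n)         ≈⟨ *-congˡ (*-congʳ (e-split 7 (7 * n) (ℕ.*-suc 7 n))) ⟩
    e (7 * (N ∸ n)) ⊗ ((e 7 ⊗ e (7 * n)) ⊗ ρ N n)     ≈⟨ solve 4 (λ a b c d → a :* ((b :* c) :* d) := b :* (a :* (c :* d))) refl _ _ _ _ ⟩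
    e 7 ⊗ (e (7 * (N ∸ n)) ⊗ (e (7 * n) ⊗ ρ N n))     ≈⟨ *-congˡ (e-∸-ρ N n) ⟩
    e 7 ⊗ (e (7 * N) ⊗ ρ N n)                         ≈⟨ *-assoc _ _ _ ⟨
    (e 7 ⊗ e (7 * N)) ⊗ ρ N n                         ≈⟨ *-congʳ (e-split 7 (7 * N) (ℕ.*-suc 7 N)) ⟨
    e (7 * suc N) ⊗ ρ N n                             ∎

  -- X and Y are the two halves of a sum over ℤ, in which the terms −c X (n + 1) and Z are −c times
  -- the shifted terms: X 0 crosses over to become Z 0.
  two-sided-shift : ∀ (c : Carrier) (X Y Z : ℕ → Carrier) → X M ≈ 0# → Z M ≈ 0# →
    Z 0 ≈ ⊖ (c ⊗ X 0) → (∀ n → Z (suc n) ≈ ⊖ (c ⊗ Y n)) →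
    ∑ M (λ n → (X n - c ⊗ X (suc n)) ⊕ (Y n ⊕ Z n)) ≈ (1# - c) ⊗ ∑ M (λ n → X n ⊕ Y n)
  two-sided-shift c X Y Z X-M Z-M Z-0 Z-suc = begin
    ∑ M (λ n → (X n - c ⊗ X (suc n)) ⊕ (Y n ⊕ Z n))
      ≈⟨ trans (∑-⊕ M _ _) (+-cong (∑-minus M _ _) (∑-⊕ M _ _)) ⟩
    (∑ M X - ∑ M (λ n → c ⊗ X (suc n))) ⊕ (∑ M Y ⊕ ∑ M Z)
      ≈⟨ +-cong (minus-cong (head X X-M) (sym (∑-distribˡ M c _))) (+-congˡ Z-sum) ⟩
    ((X 0 ⊕ ∑ M (X ∘ suc)) - c ⊗ ∑ M (X ∘ suc)) ⊕ (∑ M Y ⊕ (⊖ (c ⊗ X 0) ⊕ (⊖ c) ⊗ ∑ M Y))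
      ≈⟨ solve 4 (λ c x s y → ((x :+ s) :- c :* s) :+ (y :+ (:- (c :* x) :+ (:- c) :* y)) := (:1 :- c) :* ((x :+ s) :+ y))
               refl c (X 0) (∑ M (X ∘ suc)) (∑ M Y) ⟩
    (1# - c) ⊗ ((X 0 ⊕ ∑ M (X ∘ suc)) ⊕ ∑ M Y)
      ≈⟨ *-congˡ (trans (∑-⊕ M X Y) (+-congʳ (head X X-M))) ⟨
    (1# - c) ⊗ ∑ M (λ n → X n ⊕ Y n) ∎
    where
    head : ∀ f → f M ≈ 0# → ∑ M f ≈ f 0 ⊕ ∑ M (f ∘ suc)
    head f f-M = trans (sym (trans (+-congˡ f-M) (+-identityʳ _))) (∑-head M f)

    Z-sum : ∑ M Z ≈ ⊖ (c ⊗ X 0) ⊕ (⊖ c) ⊗ ∑ M Y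
    Z-sum = begin
      ∑ M Z                                         ≈⟨ head Z Z-M ⟩
      Z 0 ⊕ ∑ M (Z ∘ suc)                           ≈⟨ +-cong Z-0 (∑-cong M λ n → trans (Z-suc n) (solve 2 (λ x y → :- (x :* y) := (:- x) :* y) refl c (Y n))) ⟩
      ⊖ (c ⊗ X 0) ⊕ ∑ M (λ n → (⊖ c) ⊗ Y n)         ≈⟨ +-congˡ (∑-distribˡ M _ _) ⟨
      ⊖ (c ⊗ X 0) ⊕ (⊖ c) ⊗ ∑ M Y                   ∎

  -- Two-sided sums of (-1)^k q^(k(7k+1)/2) times Gaussian binomials in Q: [2N+1 choose N-k] divided
  -- by (Q)_(2N+1) in `V`, [2N+2 choose N+1-k] divided by (Q)_(2N+2) in `W`. The second part of each
  -- summand belongs to k = -n - 1.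
  V W : ℕ → Carrier
  V N = ∑ M λ n → (α n ⊕ β n) ⊗ (ρ N n ⊗ r (suc (N + n)))
  W N = ∑ M λ n → α n ⊗ (ρ (suc N) n ⊗ r (suc (N + n))) ⊕ β n ⊗ (ρ N n ⊗ r (suc (suc (N + n))))

  -- Over ℤ this is one q-Pascal rule followed by the shift from k to k + 1 in its second half; at
  -- negative indices the rule reads as `pascal₂`. The shift multiplies the theta term by -q^(7k+4),
  -- and Q^(N+k+2) / q^(7k+4) is the constant q^(7N+10).
  V-suc : ∀ N → (1# - e (7 * suc (2 * N + 2))) ⊗ V (suc N) ≈ (1# - e (7 * N + 10)) ⊗ W N
  V-suc N = begin
    (1# - e (7 * suc (2 * N + 2))) ⊗ V (suc N)       ≈⟨ ∑-distribˡ M _ _ ⟩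
    _                                                ≈⟨ ∑-cong M term ⟩
    ∑ M (λ n → (X n - C ⊗ X (suc n)) ⊕ (Y n ⊕ Z n))
      ≈⟨ two-sided-shift C X Y Z (trans (*-congʳ (α≈0 ℕ.≤-refl)) (zeroˡ _)) (trans (*-congʳ (β≈0 ℕ.≤-refl)) (zeroˡ _)) Z-0 Z-suc ⟩
    (1# - C) ⊗ W N                                   ∎
    where
    C = e (7 * N + 10)
    X Y Z : ℕ → Carrier
    X n = α n ⊗ (ρ (suc N) n ⊗ r (suc (N + n)))
    Y n = β n ⊗ (ρ N n ⊗ r (suc (suc (N + n))))
    Z n = β n ⊗ (e (7 * (suc N ∸ n)) ⊗ (ρ (suc N) n ⊗ r (suc (N + n))))

    eq : ∀ N n → n + (2 * N + 2) ≡ suc N + suc (N + n)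
    eq = solve-∀

    term : ∀ n → (1# - e (7 * suc (2 * N + 2))) ⊗ ((α n ⊕ β n) ⊗ (ρ (suc N) n ⊗ r (suc (suc N + n))))
               ≈ (X n - C ⊗ X (suc n)) ⊕ (Y n ⊕ Z n)
    term n = begin
      S ⊗ ((α n ⊕ β n) ⊗ (ρ (suc N) n ⊗ r (suc (suc N + n))))
        ≈⟨ solve 4 (λ s a b x → s :* ((a :+ b) :* x) := a :* (s :* x) :+ b :* (s :* x)) refl S (α n) (β n) _ ⟩
      α n ⊗ (S ⊗ (ρ (suc N) n ⊗ r (suc (suc N + n)))) ⊕ β n ⊗ (S ⊗ (ρ (suc N) n ⊗ r (suc (suc N + n))))
        ≈⟨ +-cong (*-congˡ (pascal₁ (suc N) n (suc (N + n)) (2 * N + 2) (eq N n)))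
                  (*-congˡ (pascal₂ (suc N) n (suc (N + n)) (2 * N + 2) (eq N n))) ⟩
      α n ⊗ (ρ (suc N) n ⊗ r (suc (N + n)) ⊕ e (7 * suc (suc (N + n))) ⊗ (ρ N n ⊗ r (suc (suc (N + n)))))
        ⊕ β n ⊗ (ρ N n ⊗ r (suc (suc (N + n))) ⊕ e (7 * (suc N ∸ n)) ⊗ (ρ (suc N) n ⊗ r (suc (N + n))))
        ≈⟨ +-cong (trans (distribˡ _ _ _) (+-congˡ shifted)) (distribˡ _ _ _) ⟩
      (X n - C ⊗ X (suc n)) ⊕ (Y n ⊕ Z n) ∎
      where
      S = 1# - e (7 * suc (2 * N + 2))

      shifted : α n ⊗ (e (7 * suc (suc (N + n))) ⊗ (ρ N n ⊗ r (suc (suc (N + n))))) ≈ ⊖ (C ⊗ X (suc n))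
      shifted = begin
        α n ⊗ (e (7 * suc (suc (N + n))) ⊗ (ρ N n ⊗ r (suc (suc (N + n)))))
          ≈⟨ *-congˡ (*-cong (e-split (7 * N + 10) (7 * n + 4) (eq′ N n))
                             (*-congˡ (reflexive (≡.cong (r ∘ suc) (≡.sym (ℕ.+-suc N n)))))) ⟩
        α n ⊗ ((C ⊗ e (7 * n + 4)) ⊗ (ρ N n ⊗ r (suc (N + suc n))))
          ≈⟨ solve 4 (λ a c x y → a :* ((c :* x) :* y) := :- (c :* ((:- (a :* x)) :* y))) refl (α n) C _ _ ⟩
        ⊖ (C ⊗ X (suc n)) ∎
        where
        eq′ : ∀ N n → 7 * suc (suc (N + n)) ≡ (7 * N + 10) + (7 * n + 4)
        eq′ = solve-∀

    Z-0 : Z 0 ≈ ⊖ (C ⊗ X 0)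
    Z-0 = begin
      (⊖ (1# ⊗ e 3)) ⊗ (e (7 * suc N) ⊗ x)     ≈⟨ solve 3 (λ a b x → (:- (:1 :* a)) :* (b :* x) := :- ((a :* b) :* (:1 :* x))) refl (e 3) _ x ⟩
      ⊖ ((e 3 ⊗ e (7 * suc N)) ⊗ (1# ⊗ x))     ≈⟨ -‿cong (*-congʳ (e-split 3 (7 * suc N) (eq₀ N))) ⟨
      ⊖ (C ⊗ X 0)                              ∎
      where
      x = r (suc N) ⊗ r (suc (N + 0))
      eq₀ : ∀ N → 7 * N + 10 ≡ 3 + 7 * suc N
      eq₀ = solve-∀

    Z-suc : ∀ n → Z (suc n) ≈ ⊖ (C ⊗ Y n)
    Z-suc n = begin
      β (suc n) ⊗ (e (7 * (N ∸ n)) ⊗ (ρ N n ⊗ r (suc (N + suc n))))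
        ≈⟨ *-cong (trans (β-suc n) (-‿cong (*-congˡ (e-+ (7 * n) 10))))
                  (*-congˡ (*-congˡ (reflexive (≡.cong (r ∘ suc) (ℕ.+-suc N n))))) ⟩
      (⊖ (β n ⊗ (e (7 * n) ⊗ e 10))) ⊗ (e (7 * (N ∸ n)) ⊗ (ρ N n ⊗ r (suc (suc (N + n)))))
        ≈⟨ solve 6 (λ b u v w x y → (:- (b :* (u :* v))) :* (w :* (x :* y)) := :- ((v :* b) :* ((w :* (u :* x)) :* y)))
                 refl (β n) (e (7 * n)) (e 10) (e (7 * (N ∸ n))) (ρ N n) _ ⟩
      ⊖ ((e 10 ⊗ β n) ⊗ ((e (7 * (N ∸ n)) ⊗ (e (7 * n) ⊗ ρ N n)) ⊗ r (suc (suc (N + n)))))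
        ≈⟨ -‿cong (*-congˡ (*-congʳ (e-∸-ρ N n))) ⟩
      ⊖ ((e 10 ⊗ β n) ⊗ ((e (7 * N) ⊗ ρ N n) ⊗ r (suc (suc (N + n)))))
        ≈⟨ solve 5 (λ v b w x y → :- ((v :* b) :* ((w :* x) :* y)) := :- ((w :* v) :* (b :* (x :* y)))) refl (e 10) (β n) (e (7 * N)) (ρ N n) _ ⟩
      ⊖ ((e (7 * N) ⊗ e 10) ⊗ Y n)
        ≈⟨ -‿cong (*-congʳ (e-+ (7 * N) 10)) ⟨
      ⊖ (C ⊗ Y n) ∎

  -- The shift now runs from k to k - 1, so the negative half `β` takes the role of `X`, and the two
  -- Pascal rules change places.
  W-step : ∀ N → (1# - e (7 * suc (2 * N + 1))) ⊗ W N ≈ (1# - e (7 * N + 4)) ⊗ V N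
  W-step N = begin
    (1# - e (7 * suc (2 * N + 1))) ⊗ W N             ≈⟨ ∑-distribˡ M _ _ ⟩
    _                                                ≈⟨ ∑-cong M term ⟩
    ∑ M (λ n → (X n - C ⊗ X (suc n)) ⊕ (Y n ⊕ Z n))
      ≈⟨ two-sided-shift C X Y Z (trans (*-congʳ (β≈0 ℕ.≤-refl)) (zeroˡ _)) (trans (*-congʳ (α≈0 ℕ.≤-refl)) (zeroˡ _)) Z-0 Z-suc ⟩
    (1# - C) ⊗ ∑ M (λ n → X n ⊕ Y n)
      ≈⟨ *-congˡ (∑-cong M λ n → trans (sym (distribʳ _ (β n) (α n))) (*-congʳ (+-comm (β n) (α n)))) ⟩
    (1# - C) ⊗ V N                                   ∎
    where
    C = e (7 * N + 4)
    X Y Z : ℕ → Carrier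
    X n = β n ⊗ (ρ N n ⊗ r (suc (N + n)))
    Y n = α n ⊗ (ρ N n ⊗ r (suc (N + n)))
    Z n = α n ⊗ (e (7 * (suc N ∸ n)) ⊗ (ρ (suc N) n ⊗ r (N + n)))

    eq₁ : ∀ N n → n + (2 * N + 1) ≡ N + suc (N + n)
    eq₁ = solve-∀
    eq₂ : ∀ N n → n + (2 * N + 1) ≡ suc N + (N + n)
    eq₂ = solve-∀

    term : ∀ n → (1# - e (7 * suc (2 * N + 1)))
                   ⊗ (α n ⊗ (ρ (suc N) n ⊗ r (suc (N + n))) ⊕ β n ⊗ (ρ N n ⊗ r (suc (suc (N + n)))))
               ≈ (X n - C ⊗ X (suc n)) ⊕ (Y n ⊕ Z n)
    term n = begin
      S ⊗ (α n ⊗ (ρ (suc N) n ⊗ r (suc (N + n))) ⊕ β n ⊗ (ρ N n ⊗ r (suc (suc (N + n)))))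
        ≈⟨ solve 5 (λ s a x b y → s :* (a :* x :+ b :* y) := b :* (s :* y) :+ a :* (s :* x)) refl S (α n) _ (β n) _ ⟩
      β n ⊗ (S ⊗ (ρ N n ⊗ r (suc (suc (N + n))))) ⊕ α n ⊗ (S ⊗ (ρ (suc N) n ⊗ r (suc (N + n))))
        ≈⟨ +-cong (*-congˡ (pascal₁ N n (suc (N + n)) (2 * N + 1) (eq₁ N n)))
                  (*-congˡ (pascal₂ (suc N) n (N + n) (2 * N + 1) (eq₂ N n))) ⟩
      β n ⊗ (ρ N n ⊗ r (suc (N + n)) ⊕ e (7 * suc (suc (N + n))) ⊗ (ρ N (suc n) ⊗ r (suc (suc (N + n)))))
        ⊕ α n ⊗ (ρ N n ⊗ r (suc (N + n)) ⊕ e (7 * (suc N ∸ n)) ⊗ (ρ (suc N) n ⊗ r (N + n)))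
        ≈⟨ +-cong (trans (distribˡ _ _ _) (+-congˡ shifted)) (distribˡ _ _ _) ⟩
      (X n - C ⊗ X (suc n)) ⊕ (Y n ⊕ Z n) ∎
      where
      S = 1# - e (7 * suc (2 * N + 1))

      shifted : β n ⊗ (e (7 * suc (suc (N + n))) ⊗ (ρ N (suc n) ⊗ r (suc (suc (N + n))))) ≈ ⊖ (C ⊗ X (suc n))
      shifted = begin
        β n ⊗ (e (7 * suc (suc (N + n))) ⊗ (ρ N (suc n) ⊗ r (suc (suc (N + n)))))
          ≈⟨ *-congˡ (*-cong (e-split (7 * N + 4) (7 * n + 10) (eq′ N n))
                             (*-congˡ (reflexive (≡.cong (r ∘ suc) (≡.sym (ℕ.+-suc N n)))))) ⟩
        β n ⊗ ((C ⊗ e (7 * n + 10)) ⊗ (ρ N (suc n) ⊗ r (suc (N + suc n))))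
          ≈⟨ solve 4 (λ a c x y → a :* ((c :* x) :* y) := :- (c :* ((:- (a :* x)) :* y))) refl (β n) C _ _ ⟩
        ⊖ (C ⊗ ((⊖ (β n ⊗ e (7 * n + 10))) ⊗ (ρ N (suc n) ⊗ r (suc (N + suc n)))))
          ≈⟨ -‿cong (*-congˡ (*-congʳ (β-suc n))) ⟨
        ⊖ (C ⊗ X (suc n)) ∎
        where
        eq′ : ∀ N n → 7 * suc (suc (N + n)) ≡ (7 * N + 4) + (7 * n + 10)
        eq′ = solve-∀

    Z-0 : Z 0 ≈ ⊖ (C ⊗ X 0)
    Z-0 = begin
      1# ⊗ (e (7 * suc N) ⊗ (r (suc N) ⊗ r (N + 0)))
        ≈⟨ *-congˡ (*-cong (e-split 3 (7 * N + 4) (eq₀ N))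
                           (*-cong (reflexive (≡.cong (r ∘ suc) (≡.sym (ℕ.+-identityʳ N)))) (reflexive (≡.cong r (ℕ.+-identityʳ N))))) ⟩
      1# ⊗ ((e 3 ⊗ C) ⊗ (r (suc (N + 0)) ⊗ r N))
        ≈⟨ solve 4 (λ a c x y → :1 :* ((a :* c) :* (y :* x)) := :- (c :* ((:- (:1 :* a)) :* (x :* y)))) refl (e 3) C _ _ ⟩
      ⊖ (C ⊗ X 0) ∎
      where
      eq₀ : ∀ N → 7 * suc N ≡ 3 + (7 * N + 4)
      eq₀ = solve-∀

    Z-suc : ∀ n → Z (suc n) ≈ ⊖ (C ⊗ Y n)
    Z-suc n = begin
      α (suc n) ⊗ (e (7 * (N ∸ n)) ⊗ (ρ N n ⊗ r (N + suc n)))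
        ≈⟨ *-cong (-‿cong (*-congˡ (e-+ (7 * n) 4)))
                  (*-congˡ (*-congˡ (reflexive (≡.cong r (ℕ.+-suc N n))))) ⟩
      (⊖ (α n ⊗ (e (7 * n) ⊗ e 4))) ⊗ (e (7 * (N ∸ n)) ⊗ (ρ N n ⊗ r (suc (N + n))))
        ≈⟨ solve 6 (λ b u v w x y → (:- (b :* (u :* v))) :* (w :* (x :* y)) := :- ((v :* b) :* ((w :* (u :* x)) :* y)))
                 refl (α n) (e (7 * n)) (e 4) (e (7 * (N ∸ n))) (ρ N n) _ ⟩
      ⊖ ((e 4 ⊗ α n) ⊗ ((e (7 * (N ∸ n)) ⊗ (e (7 * n) ⊗ ρ N n)) ⊗ r (suc (N + n))))
        ≈⟨ -‿cong (*-congˡ (*-congʳ (e-∸-ρ N n))) ⟩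
      ⊖ ((e 4 ⊗ α n) ⊗ ((e (7 * N) ⊗ ρ N n) ⊗ r (suc (N + n))))
        ≈⟨ solve 5 (λ v b w x y → :- ((v :* b) :* ((w :* x) :* y)) := :- ((w :* v) :* (b :* (x :* y)))) refl (e 4) (α n) (e (7 * N)) (ρ N n) _ ⟩
      ⊖ ((e (7 * N) ⊗ e 4) ⊗ Y n)
        ≈⟨ -‿cong (*-congʳ (e-+ (7 * N) 4)) ⟨
      ⊖ (C ⊗ Y n) ∎

  -- Going from N to N + 1 raises the upper entry of the binomials by two. It is done in two
  -- half-steps through `W`, each contributing one linear factor.
  finite-triple-product : ∀ N →
    poch (suc (2 * N)) ⊗ V N ≈ (1# - e 3) ⊗ ∏ N (λ i → (1# - e (7 * i + 4)) ⊗ (1# - e (7 * i + 10)))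
  finite-triple-product zero = begin
    poch 1 ⊗ V 0
      -- Only n = 0 survives, since `ρ 0 (suc n)` is zero.
      ≈⟨ *-congˡ (∑-first _ λ { (suc n) _ → trans (*-congˡ (zeroˡ _)) (zeroʳ _) }) ⟩
    poch 1 ⊗ ((1# ⊕ β 0) ⊗ (1# ⊗ r 1))
      ≈⟨ solve 3 (λ p x y → p :* ((:1 :+ :- (:1 :* x)) :* (:1 :* y)) := (:1 :- x) :* (p :* y)) refl (poch 1) (e 3) (r 1) ⟩
    (1# - e 3) ⊗ (poch 1 ⊗ r 1)
      ≈⟨ *-congˡ (poch⊗r 1) ⟩
    (1# - e 3) ⊗ 1# ∎
  finite-triple-product (suc N) = begin
    poch (suc (2 * suc N)) ⊗ V (suc N)
      ≡⟨ ≡.cong (λ k → poch k ⊗ V (suc N)) (eq N) ⟩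
    (poch (suc (2 * N)) ⊗ (1# - e (7 * suc (suc (2 * N)))) ⊗ (1# - e (7 * suc (suc (suc (2 * N)))))) ⊗ V (suc N)
      ≈⟨ *-congʳ (*-cong (*-congˡ (minus-cong refl (e-cong (eq₁ N)))) (minus-cong refl (e-cong (eq₂ N)))) ⟩
    (p ⊗ x ⊗ y) ⊗ V (suc N)
      ≈⟨ solve 4 (λ p x y v → (p :* x :* y) :* v := (p :* x) :* (y :* v)) refl p x y (V (suc N)) ⟩
    (p ⊗ x) ⊗ (y ⊗ V (suc N))
      ≈⟨ *-congˡ (V-suc N) ⟩
    (p ⊗ x) ⊗ (b ⊗ W N)
      ≈⟨ solve 4 (λ p x b w → (p :* x) :* (b :* w) := (p :* b) :* (x :* w)) refl p x b (W N) ⟩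
    (p ⊗ b) ⊗ (x ⊗ W N)
      ≈⟨ *-congˡ (W-step N) ⟩
    (p ⊗ b) ⊗ (a ⊗ V N)
      ≈⟨ solve 4 (λ p b a v → (p :* b) :* (a :* v) := (p :* v) :* (a :* b)) refl p b a (V N) ⟩
    (p ⊗ V N) ⊗ (a ⊗ b)
      ≈⟨ *-congʳ (finite-triple-product N) ⟩
    ((1# - e 3) ⊗ _) ⊗ (a ⊗ b)
      ≈⟨ *-assoc _ _ _ ⟩
    _ ∎
    where
    p = poch (suc (2 * N))
    x = 1# - e (7 * suc (2 * N + 1))
    y = 1# - e (7 * suc (2 * N + 2))
    a = 1# - e (7 * N + 4)
    b = 1# - e (7 * N + 10)
    eq : ∀ N → suc (2 * suc N) ≡ suc (suc (suc (2 * N)))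
    eq = solve-∀
    eq₁ : ∀ N → 7 * suc (suc (2 * N)) ≡ 7 * suc (2 * N + 1)
    eq₁ = solve-∀
    eq₂ : ∀ N → 7 * suc (suc (suc (2 * N))) ≡ 7 * suc (2 * N + 2)
    eq₂ = solve-∀

  M≤7k+ : ∀ {k} a → M ≤ k → M ≤ 7 * k + a
  M≤7k+ {k} a M≤k = ℕ.≤-trans M≤k (ℕ.≤-trans (ℕ.m≤n*m k 7) (ℕ.m≤m+n _ a))

  poch-stable : ∀ {k} → M ≤ k → poch k ≈ poch M
  poch-stable = ∏-stable λ i M≤i → 1-e≈1 (ℕ.≤-trans (ℕ.m≤n⇒m≤1+n M≤i) (ℕ.m≤n*m (suc i) 7))

  r-stable : ∀ {k} → M ≤ k → r k ≈ r M
  r-stable {k} M≤k = begin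
    r k                       ≈⟨ *-identityˡ _ ⟨
    1# ⊗ r k                  ≈⟨ *-congʳ (poch⊗r M) ⟨
    (poch M ⊗ r M) ⊗ r k      ≈⟨ solve 3 (λ p x y → (p :* x) :* y := (p :* y) :* x) refl _ _ _ ⟩
    (poch M ⊗ r k) ⊗ r M      ≈⟨ *-congʳ (*-congʳ (poch-stable M≤k)) ⟨
    (poch k ⊗ r k) ⊗ r M      ≈⟨ *-congʳ (poch⊗r k) ⟩
    1# ⊗ r M                  ≈⟨ *-identityˡ _ ⟩
    r M                       ∎

  ρ≡r : ∀ N n → n ≤ N → ρ N n ≡ r (N ∸ n)
  ρ≡r N       zero    _         = ≡.refl
  ρ≡r (suc N) (suc n) (s≤s n≤N) = ρ≡r N n n≤N

  triple-product : θ ≈ ∏ M λ i → ((1# - e (7 * i + 3)) ⊗ (1# - e (7 * i + 4))) ⊗ (1# - e (7 * i + 7))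
  triple-product = begin
    θ
      ≈⟨ solve 1 (λ t → t := :1 :* :1 :* t) refl θ ⟩
    1# ⊗ 1# ⊗ θ
      ≈⟨ *-congʳ (*-cong (poch⊗r M) (poch⊗r M)) ⟨
    (poch M ⊗ r M) ⊗ (poch M ⊗ r M) ⊗ θ
      ≈⟨ solve 3 (λ p x t → (p :* x) :* (p :* x) :* t := (p :* (x :* x :* t)) :* p) refl _ _ _ ⟩
    (poch M ⊗ (r M ⊗ r M ⊗ θ)) ⊗ poch M
      ≈⟨ *-congʳ (*-cong (sym (poch-stable M≤1+4M)) (sym V-limit)) ⟩
    -- At N = 2M every n < M has N - n and N + n + 1 both at least M, so all the `r` in `V` equal
    -- `r M` and the sum becomes `θ`. One `poch M` is spent on the finite product; the other
    -- supplies the factors for multiples of 7.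
    (poch (suc (2 * (2 * M))) ⊗ V (2 * M)) ⊗ poch M
      ≈⟨ *-congʳ (finite-triple-product (2 * M)) ⟩
    ((1# - e 3) ⊗ ∏ (2 * M) (λ i → (1# - e (7 * i + 4)) ⊗ (1# - e (7 * i + 10)))) ⊗ poch M
      ≈⟨ *-congʳ (*-congˡ (∏-⊗ (2 * M) _ _)) ⟩
    ((1# - e 3) ⊗ (∏ (2 * M) (λ i → 1# - e (7 * i + 4)) ⊗ ∏ (2 * M) (λ i → 1# - e (7 * i + 10)))) ⊗ poch M
      ≈⟨ solve 4 (λ a x y p → (a :* (x :* y)) :* p := ((a :* y) :* x) :* p) refl _ _ _ _ ⟩
    (((1# - e 3) ⊗ ∏ (2 * M) (λ i → 1# - e (7 * i + 10))) ⊗ ∏ (2 * M) (λ i → 1# - e (7 * i + 4))) ⊗ poch M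
      ≈⟨ *-cong (*-cong threes (∏-stable (λ i M≤i → 1-e≈1 (M≤7k+ 4 M≤i)) (ℕ.m≤n*m M 2)))
                (∏-cong M λ i → minus-cong refl (e-cong (eq₇ i))) ⟩
    (∏ M (λ i → 1# - e (7 * i + 3)) ⊗ ∏ M (λ i → 1# - e (7 * i + 4))) ⊗ ∏ M (λ i → 1# - e (7 * i + 7))
      ≈⟨ *-congʳ (∏-⊗ M _ _) ⟨
    ∏ M (λ i → (1# - e (7 * i + 3)) ⊗ (1# - e (7 * i + 4))) ⊗ ∏ M (λ i → 1# - e (7 * i + 7))
      ≈⟨ ∏-⊗ M _ _ ⟨
    ∏ M (λ i → ((1# - e (7 * i + 3)) ⊗ (1# - e (7 * i + 4))) ⊗ (1# - e (7 * i + 7))) ∎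
    where
    M≤1+4M : M ≤ suc (2 * (2 * M))
    M≤1+4M = ℕ.m≤n⇒m≤1+n (ℕ.≤-trans (ℕ.m≤n*m M 2) (ℕ.m≤n*m (2 * M) 2))

    eq₇ : ∀ i → 7 * suc i ≡ 7 * i + 7
    eq₇ = solve-∀

    V-limit : V (2 * M) ≈ r M ⊗ r M ⊗ θ
    V-limit = begin
      V (2 * M)                                                     ≈⟨ ∑-cong< M limit ⟩
      ∑ M (λ n → (r M ⊗ r M) ⊗ (α n ⊗ (1# - e (6 * n + 3))))        ≈⟨ ∑-distribˡ M _ _ ⟨
      r M ⊗ r M ⊗ θ                                                 ∎
      where
      limit : ∀ n → n < M → (α n ⊕ β n) ⊗ (ρ (2 * M) n ⊗ r (suc (2 * M + n))) ≈ (r M ⊗ r M) ⊗ (α n ⊗ (1# - e (6 * n + 3)))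
      limit n n<M = begin
        (α n ⊕ β n) ⊗ (ρ (2 * M) n ⊗ r (suc (2 * M + n)))
          ≈⟨ *-congˡ (*-cong (trans (reflexive (ρ≡r (2 * M) n n≤2M)) (r-stable M≤2M∸n))
                             (r-stable (ℕ.m≤n⇒m≤1+n (ℕ.≤-trans (ℕ.m≤n*m M 2) (ℕ.m≤m+n _ n))))) ⟩
        (α n ⊕ β n) ⊗ (r M ⊗ r M)
          ≈⟨ solve 3 (λ a x y → (a :+ :- (a :* x)) :* y := y :* (a :* (:1 :- x))) refl _ _ _ ⟩
        (r M ⊗ r M) ⊗ (α n ⊗ (1# - e (6 * n + 3))) ∎
        where
        n≤2M : n ≤ 2 * M
        n≤2M = ℕ.≤-trans (ℕ.<⇒≤ n<M) (ℕ.m≤n*m M 2)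
        M≤2M∸n : M ≤ 2 * M ∸ n
        M≤2M∸n = ≡.subst (_≤ 2 * M ∸ n) (≡.trans (ℕ.m+n∸m≡n M (M + 0)) (ℕ.+-identityʳ M)) (ℕ.∸-monoʳ-≤ (2 * M) (ℕ.<⇒≤ n<M))

    -- The isolated factor 1 - q^3 is the missing first member of the progression that the finite
    -- product starts at 10.
    threes : (1# - e 3) ⊗ ∏ (2 * M) (λ i → 1# - e (7 * i + 10)) ≈ ∏ M (λ i → 1# - e (7 * i + 3))
    threes = begin
      (1# - e 3) ⊗ ∏ (2 * M) (λ i → 1# - e (7 * i + 10))
        ≈⟨ *-congˡ (∏-cong (2 * M) λ i → minus-cong refl (e-cong (eq i))) ⟩
      (1# - e 3) ⊗ ∏ (2 * M) (λ i → 1# - e (7 * suc i + 3))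
        ≈⟨ ∏-head (2 * M) (λ i → 1# - e (7 * i + 3)) ⟨
      ∏ (suc (2 * M)) (λ i → 1# - e (7 * i + 3))
        ≈⟨ ∏-stable (λ i M≤i → 1-e≈1 (M≤7k+ 3 M≤i)) (ℕ.m≤n⇒m≤1+n (ℕ.m≤n*m M 2)) ⟩
      ∏ M (λ i → 1# - e (7 * i + 3)) ∎
      where
      eq : ∀ i → 7 * i + 10 ≡ 7 * suc i + 3
      eq = solve-∀

  factor : ℕ → Carrier
  factor k = if admissible (suc k % 7) then geometric (suc k) else 1#

  -- In E times the right side, an admissible residue gives (1 - q^k) / (1 - q^k) = 1 and the
  -- residues 3, 4, 0 leave 1 - q^k. Each block of seven factors is thus one factor of the triple
  -- product, and the range M * 7 consists of whole blocks.
  rogers–selberg : F 0 ≈ ∏ (M * 7) factor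
  rogers–selberg = euler-cancel (begin
    euler ⊗ F 0
      ≈⟨ G≈euler⊗F 0 ⟨
    G 0
      ≈⟨ trans G₀≈θ triple-product ⟩
    ∏ M (λ i → ((1# - e (7 * i + 3)) ⊗ (1# - e (7 * i + 4))) ⊗ (1# - e (7 * i + 7)))
      ≈⟨ ∏-cong M block ⟨
    ∏ M (λ i → ∏ 7 (λ j → u (j + i * 7)))
      ≈⟨ ∏-* M 7 u ⟨
    ∏ (M * 7) u
      ≈⟨ ∏-⊗ (M * 7) _ _ ⟩
    h (M * 7) 0 ⊗ ∏ (M * 7) factor
      ≈⟨ *-congʳ (h₀-stable (ℕ.m≤m*n M 7)) ⟩
    euler ⊗ ∏ (M * 7) factor ∎)
    where
    u : ℕ → Carrier
    u k = (1# - e (suc k)) ⊗ factor k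

    residue : ∀ j i → admissible (suc (j + i * 7) % 7) ≡ admissible (suc j % 7)
    residue j i = ≡.cong admissible ([m+kn]%n≡m%n (suc j) i 7)

    u-admissible : ∀ j i → admissible (suc j % 7) ≡ true → u (j + i * 7) ≈ 1#
    u-admissible j i eq rewrite residue j i | eq = geometric-inverse (suc (j + i * 7))

    u-forbidden : ∀ j i → admissible (suc j % 7) ≡ false → u (j + i * 7) ≈ 1# - e (7 * i + suc j)
    u-forbidden j i eq rewrite residue j i | eq = trans (*-identityʳ _) (minus-cong refl (e-cong (eq′ i j)))
      where
      eq′ : ∀ i j → suc (j + i * 7) ≡ 7 * i + suc j
      eq′ = solve-∀

    block : ∀ i → ∏ 7 (λ j → u (j + i * 7)) ≈ ((1# - e (7 * i + 3)) ⊗ (1# - e (7 * i + 4))) ⊗ (1# - e (7 * i + 7))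
    block i = begin
      ∏ 7 (λ j → u (j + i * 7))
        ≈⟨ *-cong (*-cong (*-cong (*-cong (*-cong (*-cong (*-congˡ
             (u-admissible 0 i ≡.refl)) (u-admissible 1 i ≡.refl)) (u-forbidden 2 i ≡.refl)) (u-forbidden 3 i ≡.refl))
             (u-admissible 4 i ≡.refl)) (u-admissible 5 i ≡.refl)) (u-forbidden 6 i ≡.refl) ⟩
      _ ≈⟨ solve 3 (λ x y z → :1 :* :1 :* :1 :* x :* y :* :1 :* :1 :* z := x :* y :* z) refl _ _ _ ⟩
      _ ∎

    -- Each factor 1 - q^(j+1) is inverted by a geometric series, so `euler` is a unit.
    euler-cancel : ∀ {x y} → euler ⊗ x ≈ euler ⊗ y → x ≈ y
    euler-cancel {x} {y} eq = begin
      x                         ≈⟨ unit x ⟨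
      inv ⊗ (euler ⊗ x)         ≈⟨ *-congˡ eq ⟩
      inv ⊗ (euler ⊗ y)         ≈⟨ unit y ⟩
      y                         ∎
      where
      inv = ∏ M λ j → geometric (suc j)
      unit : ∀ z → inv ⊗ (euler ⊗ z) ≈ z
      unit z = begin
        inv ⊗ (euler ⊗ z)       ≈⟨ solve 3 (λ i d z → i :* (d :* z) := (d :* i) :* z) refl _ _ _ ⟩
        (euler ⊗ inv) ⊗ z       ≈⟨ *-congʳ (trans (sym (∏-⊗ M _ _)) (∏-one M λ j _ → geometric-inverse (suc j))) ⟩
        1# ⊗ z                  ≈⟨ *-identityˡ z ⟩
        z                       ∎

-- The multiplicities allowed for the part k, among those below M, for a partition
-- counted by A₃ with witness j and for one counted by C₃₃.
A₃-multiplicities : ℕ → ℕ → ℕ → List ℕ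
A₃-multiplicities M j k =
  if does (k ℕ.≤? j * 2)
  then (if does (k % 2 ℕ.≟ 1) then 2 ∷ [] else downFrom M)
  else 1 ∷ 0 ∷ []

A₃-multiplicities-large : ∀ M j k → j * 2 < k → A₃-multiplicities M j k ≡ 1 ∷ 0 ∷ []
A₃-multiplicities-large M j k 2j<k rewrite dec-false (k ℕ.≤? j * 2) (ℕ.<⇒≱ 2j<k) = ≡.refl

A₃-multiplicities-odd : ∀ M j k → k ≤ j * 2 → k % 2 ≡ 1 → A₃-multiplicities M j k ≡ 2 ∷ []
A₃-multiplicities-odd M j k k≤2j odd
  rewrite dec-true (k ℕ.≤? j * 2) k≤2j | dec-true (k % 2 ℕ.≟ 1) odd = ≡.refl

A₃-multiplicities-even : ∀ M j k → k ≤ j * 2 → k % 2 ≢ 1 → A₃-multiplicities M j k ≡ downFrom M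
A₃-multiplicities-even M j k k≤2j ¬odd
  rewrite dec-true (k ℕ.≤? j * 2) k≤2j | dec-false (k % 2 ℕ.≟ 1) ¬odd = ≡.refl

C₃₃-multiplicities : ℕ → ℕ → List ℕ
C₃₃-multiplicities M k = if admissible (k % 7) then downFrom M else 0 ∷ []

-- Both generating functions as products over part sizes.

module GeneratingFunctions {c ℓ} {R : CommutativeRing c ℓ} {M : ℕ} (powers : NilpotentPowers R M) where
  open TripleProduct powers public
  open Relation.Binary.Reasoning.Setoid setoid

  weight : ℕ → List ℕ → Carrier
  weight k = foldr (λ a x → e (a * k) ⊕ x) 0#

  weight-downFrom : ∀ k → weight k (downFrom M) ≈ geometric k
  weight-downFrom k = partial M
    where
    partial : ∀ n → weight k (downFrom n) ≈ ∑ n λ i → e (i * k)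
    partial zero    = refl
    partial (suc n) = trans (+-congˡ (partial n)) (+-comm _ _)

  gf : (ℕ → List ℕ) → ℕ → Carrier
  gf S K = ∏ K λ k → weight (suc k) (S (suc k))

  gf-C₃₃ : gf (C₃₃-multiplicities M) (M * 7) ≈ ∏ (M * 7) factor
  gf-C₃₃ = ∏-cong (M * 7) λ k → choose k (admissible (suc k % 7))
    where
    choose : ∀ k b → weight (suc k) (if b then downFrom M else 0 ∷ []) ≈ (if b then geometric (suc k) else 1#)
    choose k true  = weight-downFrom (suc k)
    choose k false = trans (+-identityʳ _) e-zero

  -- Up to 2j the parts are taken in pairs: 2i + 1 used twice gives q^(2(2i+1)), and these multiply
  -- to q^(2j²); 2i + 2 gives a geometric series. The bound M + 2j leaves exactly the M factors of
  -- `distinctFrom`.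
  gf-A₃ : ∀ j → gf (A₃-multiplicities M j) (M + j * 2) ≈ F-term 0 j
  gf-A₃ j = begin
    gf S (M + j * 2)
      ≈⟨ ∏-+ (j * 2) M w ⟩
    ∏ (j * 2) w ⊗ ∏ M (λ i → w (i + j * 2))
      ≈⟨ *-cong (∏-* j 2 w) (∏-cong M large) ⟩
    ∏ j (λ i → ∏ 2 (λ t → w (t + i * 2))) ⊗ distinctFrom (2 * j)
      ≈⟨ *-congʳ (∏-cong< j small) ⟩
    ∏ j (λ i → e (2 * suc (i * 2)) ⊗ geometric (2 * suc i)) ⊗ distinctFrom (2 * j)
      ≈⟨ *-congʳ (∏-⊗ j _ _) ⟩
    (∏ j (λ i → e (2 * suc (i * 2))) ⊗ evens j) ⊗ distinctFrom (2 * j)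
      ≈⟨ *-assoc _ _ _ ⟩
    ∏ j (λ i → e (2 * suc (i * 2))) ⊗ (evens j ⊗ distinctFrom (2 * j))
      ≈⟨ *-congʳ (odds j) ⟩
    F-term 0 j ∎
    where
    S = A₃-multiplicities M j
    w : ℕ → Carrier
    w k = weight (suc k) (S (suc k))

    odds : ∀ n → ∏ n (λ i → e (2 * suc (i * 2))) ≈ e (2 * n * n)
    odds zero    = sym e-zero
    odds (suc n) = trans (*-congʳ (odds n)) (sym (e-split (2 * n * n) (2 * suc (n * 2)) (eq n)))
      where
      eq : ∀ n → 2 * suc n * suc n ≡ 2 * n * n + 2 * suc (n * 2)
      eq = solve-∀

    large : ∀ i → w (i + j * 2) ≈ 1# ⊕ e (suc (2 * j + i))
    large i rewrite A₃-multiplicities-large M j (suc (i + j * 2)) (s≤s (ℕ.m≤n+m (j * 2) i)) = begin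
      e (1 * suc (i + j * 2)) ⊕ (e 0 ⊕ 0#)      ≈⟨ +-cong (e-cong (eq i j)) (trans (+-identityʳ _) e-zero) ⟩
      e (suc (2 * j + i)) ⊕ 1#                  ≈⟨ +-comm _ _ ⟩
      1# ⊕ e (suc (2 * j + i))                  ∎
      where
      eq : ∀ i j → 1 * suc (i + j * 2) ≡ suc (2 * j + i)
      eq = solve-∀

    small : ∀ i → i < j → ∏ 2 (λ t → w (t + i * 2)) ≈ e (2 * suc (i * 2)) ⊗ geometric (2 * suc i)
    small i i<j = *-cong (trans (*-identityˡ _) odd) even
      where
      even≤ : suc (1 + i * 2) ≤ j * 2
      even≤ = ℕ.*-monoˡ-≤ 2 i<j

      residue : ∀ t → suc (t + i * 2) % 2 ≡ suc t % 2
      residue t = [m+kn]%n≡m%n (suc t) i 2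

      odd : w (i * 2) ≈ e (2 * suc (i * 2))
      odd rewrite A₃-multiplicities-odd M j (suc (i * 2)) (ℕ.<⇒≤ even≤) (residue 0) = +-identityʳ _

      even : w (1 + i * 2) ≈ geometric (2 * suc i)
      even rewrite A₃-multiplicities-even M j (suc (1 + i * 2)) even≤ (λ odd → ℕ.0≢1+n (≡.trans (≡.sym (residue 1)) odd)) =
        trans (weight-downFrom _) (reflexive (≡.cong geometric (ℕ.*-comm (suc i) 2)))

  generating-functions-agree :
    ∑ M (λ j → gf (A₃-multiplicities M j) (M + j * 2)) ≈ gf (C₃₃-multiplicities M) (M * 7)
  generating-functions-agree = trans (∑-cong M gf-A₃) (trans rogers–selberg (sym gf-C₃₃))

-- Integer power series modulo q^M.

Series : Set
Series = ℕ → ℤ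

private
  variable
    f f′ g g′ h : Series

-- The Cauchy product, computed from f = f(0) + q (f ∘ suc), so that proofs go by recursion on the
-- degree.
convolve : Series → Series → Series
convolve f g zero    = f 0 ℤ.* g 0
convolve f g (suc n) = f 0 ℤ.* g (suc n) ℤ.+ convolve (f ∘ suc) g n

one : Series
one zero    = 1ℤ
one (suc _) = 0ℤ

shift : Series → Series
shift f zero    = 0ℤ
shift f (suc n) = f n

power : ℕ → Series
power zero    = one
power (suc k) = shift (power k)

convolve-cong : ∀ n → (∀ i → i ≤ n → f i ≡ f′ i) → (∀ i → i ≤ n → g i ≡ g′ i) →
                convolve f g n ≡ convolve f′ g′ n
convolve-cong zero    f≡f′ g≡g′ = ≡.cong₂ ℤ._*_ (f≡f′ 0 z≤n) (g≡g′ 0 z≤n)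
convolve-cong (suc n) f≡f′ g≡g′ = ≡.cong₂ ℤ._+_
  (≡.cong₂ ℤ._*_ (f≡f′ 0 z≤n) (g≡g′ (suc n) ℕ.≤-refl))
  (convolve-cong n (λ i i≤n → f≡f′ (suc i) (s≤s i≤n)) (λ i i≤n → g≡g′ i (ℕ.m≤n⇒m≤1+n i≤n)))

convolve-zeroˡ : ∀ g n → convolve (λ _ → 0ℤ) g n ≡ 0ℤ
convolve-zeroˡ g zero    = ≡.refl
convolve-zeroˡ g (suc n) = ≡.trans (ℤ.+-identityˡ _) (convolve-zeroˡ g n)

convolve-identityˡ : ∀ g n → convolve one g n ≡ g n
convolve-identityˡ g zero    = ℤ.*-identityˡ (g 0)
convolve-identityˡ g (suc n) =
  ≡.trans (≡.cong₂ ℤ._+_ (ℤ.*-identityˡ (g (suc n))) (convolve-zeroˡ g n)) (ℤ.+-identityʳ _)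

convolve-shiftˡ : ∀ f g n → convolve (shift f) g n ≡ shift (convolve f g) n
convolve-shiftˡ f g zero    = ≡.refl
convolve-shiftˡ f g (suc n) = ℤ.+-identityˡ _

convolve-distribʳ : ∀ h f g n → convolve (λ i → f i ℤ.+ g i) h n ≡ convolve f h n ℤ.+ convolve g h n
convolve-distribʳ h f g zero    = ℤ.*-distribʳ-+ (h 0) (f 0) (g 0)
convolve-distribʳ h f g (suc n) =
  ≡.trans (≡.cong (ℤ._+_ ((f 0 ℤ.+ g 0) ℤ.* h (suc n))) (convolve-distribʳ h (f ∘ suc) (g ∘ suc) n)) (rearrange (f 0) (g 0) (h (suc n)) _ _)
  where
  rearrange : ∀ a b c x y → (a ℤ.+ b) ℤ.* c ℤ.+ (x ℤ.+ y) ≡ (a ℤ.* c ℤ.+ x) ℤ.+ (b ℤ.* c ℤ.+ y)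
  rearrange = ℤ-Solver.solve-∀

convolve-scaleˡ : ∀ a f g n → convolve (λ i → a ℤ.* f i) g n ≡ a ℤ.* convolve f g n
convolve-scaleˡ a f g zero    = ℤ.*-assoc a (f 0) (g 0)
convolve-scaleˡ a f g (suc n) =
  ≡.trans (≡.cong (ℤ._+_ (a ℤ.* f 0 ℤ.* g (suc n))) (convolve-scaleˡ a (f ∘ suc) g n)) (rearrange a (f 0) (g (suc n)) _)
  where
  rearrange : ∀ a b c x → (a ℤ.* b) ℤ.* c ℤ.+ a ℤ.* x ≡ a ℤ.* (b ℤ.* c ℤ.+ x)
  rearrange = ℤ-Solver.solve-∀

-- The tail of f g is f(0) (g ∘ suc) + (f ∘ suc) g, so linearity in the left factor reduces the
-- claim to a smaller degree.
convolve-assoc : ∀ f g h n → convolve (convolve f g) h n ≡ convolve f (convolve g h) n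
convolve-assoc f g h zero    = ℤ.*-assoc (f 0) (g 0) (h 0)
convolve-assoc f g h (suc n) = begin
  f 0 ℤ.* g 0 ℤ.* h (suc n) ℤ.+ convolve (convolve f g ∘ suc) h n
    ≡⟨ ≡.cong (ℤ._+_ (f 0 ℤ.* g 0 ℤ.* h (suc n))) (convolve-distribʳ h (λ i → f 0 ℤ.* g (suc i)) (convolve (f ∘ suc) g) n) ⟩
  f 0 ℤ.* g 0 ℤ.* h (suc n) ℤ.+ (convolve (λ i → f 0 ℤ.* g (suc i)) h n ℤ.+ convolve (convolve (f ∘ suc) g) h n)
    ≡⟨ ≡.cong (ℤ._+_ (f 0 ℤ.* g 0 ℤ.* h (suc n))) (≡.cong₂ ℤ._+_ (convolve-scaleˡ (f 0) (g ∘ suc) h n) (convolve-assoc (f ∘ suc) g h n)) ⟩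
  f 0 ℤ.* g 0 ℤ.* h (suc n) ℤ.+ (f 0 ℤ.* convolve (g ∘ suc) h n ℤ.+ convolve (f ∘ suc) (convolve g h) n)
    ≡⟨ rearrange (f 0) (g 0) (h (suc n)) _ _ ⟩
  convolve f (convolve g h) (suc n) ∎
  where
  open ≡.≡-Reasoning
  rearrange : ∀ a b c x y → a ℤ.* b ℤ.* c ℤ.+ (a ℤ.* x ℤ.+ y) ≡ a ℤ.* (b ℤ.* c ℤ.+ x) ℤ.+ y
  rearrange = ℤ-Solver.solve-∀

-- The recursion peels only the left factor. Peeling each side in turn uses the claim twice at
-- degree n + 1 and once at n, hence the two base cases.
convolve-comm : ∀ f g n → convolve f g n ≡ convolve g f n
convolve-comm f g zero          = ℤ.*-comm (f 0) (g 0)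
convolve-comm f g (suc zero)    = rearrange (f 0) (g 1) (f 1) (g 0)
  where
  rearrange : ∀ a b c d → a ℤ.* b ℤ.+ c ℤ.* d ≡ d ℤ.* c ℤ.+ b ℤ.* a
  rearrange = ℤ-Solver.solve-∀
convolve-comm f g (suc (suc n)) = begin
  f 0 ℤ.* g (suc (suc n)) ℤ.+ convolve (f ∘ suc) g (suc n)
    ≡⟨ ≡.cong (ℤ._+_ (f 0 ℤ.* g (suc (suc n)))) (convolve-comm (f ∘ suc) g (suc n)) ⟩
  f 0 ℤ.* g (suc (suc n)) ℤ.+ (g 0 ℤ.* f (suc (suc n)) ℤ.+ convolve (g ∘ suc) (f ∘ suc) n)
    ≡⟨ ≡.cong (λ x → f 0 ℤ.* g (suc (suc n)) ℤ.+ (g 0 ℤ.* f (suc (suc n)) ℤ.+ x)) (convolve-comm (g ∘ suc) (f ∘ suc) n) ⟩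
  f 0 ℤ.* g (suc (suc n)) ℤ.+ (g 0 ℤ.* f (suc (suc n)) ℤ.+ convolve (f ∘ suc) (g ∘ suc) n)
    ≡⟨ rearrange (f 0 ℤ.* g (suc (suc n))) (g 0 ℤ.* f (suc (suc n))) _ ⟩
  g 0 ℤ.* f (suc (suc n)) ℤ.+ convolve f (g ∘ suc) (suc n)
    ≡⟨ ≡.cong (ℤ._+_ (g 0 ℤ.* f (suc (suc n)))) (convolve-comm f (g ∘ suc) (suc n)) ⟩
  convolve g f (suc (suc n)) ∎
  where
  open ≡.≡-Reasoning
  rearrange : ∀ a b x → a ℤ.+ (b ℤ.+ x) ≡ b ℤ.+ (a ℤ.+ x)
  rearrange = ℤ-Solver.solve-∀

power-+ : ∀ a b n → power (a + b) n ≡ convolve (power a) (power b) n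
power-+ zero    b n = ≡.sym (convolve-identityˡ (power b) n)
power-+ (suc a) b n = ≡.trans (shifted n) (≡.sym (convolve-shiftˡ (power a) (power b) n))
  where
  shifted : ∀ n → power (suc a + b) n ≡ shift (convolve (power a) (power b)) n
  shifted zero    = ≡.refl
  shifted (suc n) = power-+ a b n

power-below : ∀ {k n} → n < k → power k n ≡ 0ℤ
power-below {suc k} {zero}  _         = ≡.refl
power-below {suc k} {suc n} (s≤s n<k) = power-below n<k

-- ℤ[[q]] modulo q^M
truncated : ℕ → CommutativeRing Level.zero Level.zero
truncated M = record
  { Carrier = Series
  ; _≈_     = λ f g → ∀ n → n < M → f n ≡ g n
  ; _+_     = λ f g n → f n ℤ.+ g n
  ; _*_     = convolve
  ; -_      = λ f n → ℤ.- f n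
  ; 0#      = λ _ → 0ℤ
  ; 1#      = one
  ; isCommutativeRing = record
    { isRing = record
      { +-isAbelianGroup = record
        { isGroup = record
          { isMonoid = record
            { isSemigroup = record
              { isMagma = record
                { isEquivalence = record
                  { refl  = λ _ _ → ≡.refl
                  ; sym   = λ f≈g n n<M → ≡.sym (f≈g n n<M)
                  ; trans = λ f≈g g≈h n n<M → ≡.trans (f≈g n n<M) (g≈h n n<M)
                  }
                ; ∙-cong = λ f≈f′ g≈g′ n n<M → ≡.cong₂ ℤ._+_ (f≈f′ n n<M) (g≈g′ n n<M)
                }
              ; assoc = λ f g h n _ → ℤ.+-assoc (f n) (g n) (h n)
              }
            ; identity = (λ f n _ → ℤ.+-identityˡ (f n)) , (λ f n _ → ℤ.+-identityʳ (f n))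
            }
          ; inverse = (λ f n _ → ℤ.+-inverseˡ (f n)) , (λ f n _ → ℤ.+-inverseʳ (f n))
          ; ⁻¹-cong = λ f≈g n n<M → ≡.cong ℤ.-_ (f≈g n n<M)
          }
        ; comm = λ f g n _ → ℤ.+-comm (f n) (g n)
        }
      ; *-cong = λ f≈f′ g≈g′ n n<M → convolve-cong n
          (λ i i≤n → f≈f′ i (ℕ.≤-<-trans i≤n n<M)) (λ i i≤n → g≈g′ i (ℕ.≤-<-trans i≤n n<M))
      ; *-assoc    = λ f g h n _ → convolve-assoc f g h n
      ; *-identity = (λ f n _ → convolve-identityˡ f n)
                   , (λ f n _ → ≡.trans (convolve-comm f one n) (convolve-identityˡ f n))
      ; distrib    = (λ h f g n _ → ≡.trans (convolve-comm h _ n) (≡.trans (convolve-distribʳ h f g n)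
                       (≡.cong₂ ℤ._+_ (convolve-comm f h n) (convolve-comm g h n))))
                   , (λ h f g n _ → convolve-distribʳ h f g n)
      }
    ; *-comm = λ f g n _ → convolve-comm f g n
    }
  }

truncated-powers : ∀ {M} → 0 < M → NilpotentPowers (truncated M) M
truncated-powers 0<M = record
  { 0<M    = 0<M
  ; e      = power
  ; e-zero = λ _ _ → ≡.refl
  ; e-+    = λ a b n _ → power-+ a b n
  ; e-≥M   = λ M≤k n n<M → power-below (ℕ.<-≤-trans n<M M≤k)
  }

-- Enumerating partitions with prescribed multiplicities.

private
  variable
    A B : Set
    S : ℕ → List ℕ
    ps qs : List ℕ

concatMap-unique : ∀ {f : A → List B} {xs} → Unique xs → (∀ x → Unique (f x)) →
                   (∀ {x y z} → z ∈ f x → z ∈ f y → x ≡ y) → Unique (concatMap f xs)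
concatMap-unique         []           f! disjoint = []
concatMap-unique {f = f} (x∉xs ∷ xs!) f! disjoint =
  Unique.++⁺ (f! _) (concatMap-unique xs! f! disjoint) λ (z∈fx , z∈rest) →
    let y , y∈xs , z∈fy = find (∈-concatMap⁻ f z∈rest)
    in All.lookup x∉xs y∈xs (disjoint z∈fx z∈fy)

-- Multiplication by q^d on families of lists, with the same recursion as `power`; degrees below d
-- receive no element.
delay : ℕ → (ℕ → List A) → ℕ → List A
delay zero    f n       = f n
delay (suc d) f zero    = []
delay (suc d) f (suc n) = delay d f n

∈-delay⁺ : ∀ d {f : ℕ → List A} {x n} → x ∈ f n → x ∈ delay d f (d + n)
∈-delay⁺ zero    x∈fn = x∈fn
∈-delay⁺ (suc d) x∈fn = ∈-delay⁺ d x∈fn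

∈-delay⁻ : ∀ d {f : ℕ → List A} {x} n → x ∈ delay d f n → ∃[ k ] n ≡ d + k × x ∈ f k
∈-delay⁻ zero    n       x∈ = n , ≡.refl , x∈
∈-delay⁻ (suc d) (suc n) x∈ with k , n≡d+k , x∈fk ← ∈-delay⁻ d n x∈ = k , ≡.cong suc n≡d+k , x∈fk

delay-unique : ∀ d {f : ℕ → List A} → (∀ n → Unique (f n)) → ∀ n → Unique (delay d f n)
delay-unique zero    f! n       = f! n
delay-unique (suc d) f! zero    = []
delay-unique (suc d) f! (suc n) = delay-unique d f! n

length-delay : ∀ d (f : ℕ → List A) n →
               + length (delay d f n) ≡ convolve (power d) (λ i → + length (f i)) n
length-delay zero    f n       = ≡.sym (convolve-identityˡ (λ i → + length (f i)) n)
length-delay (suc d) f zero    = ≡.refl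
length-delay (suc d) f (suc n) =
  ≡.trans (length-delay d f n) (≡.sym (convolve-shiftˡ (power d) (λ i → + length (f i)) (suc n)))

-- Follows `gf` factor by factor: choose the multiplicity a of the largest size K + 1, then fill the
-- remaining n - a(K + 1) with smaller parts.
restricted : (ℕ → List ℕ) → ℕ → ℕ → List (List ℕ)
restricted S zero    zero    = [] ∷ []
restricted S zero    (suc n) = []
restricted S (suc K) n       =
  concatMap (λ a → map (replicate a (suc K) ++_) (delay (a * suc K) (restricted S K) n)) (S (suc K))

-- Prefixing K in `bounded` states the order and the bound at once, in the form in which copies of a
-- new largest part are prepended.
record IsRestricted (S : ℕ → List ℕ) (K n : ℕ) (ps : List ℕ) : Set where
  constructor isRestricted
  field
    partition      : IsPartition n ps
    bounded        : Linked _≥_ (K ∷ ps)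
    multiplicities : ∀ k → 0 < k → k ≤ K → m k ps ∈ S k

m-++ : ∀ j ps qs → m j (ps ++ qs) ≡ m j ps + m j qs
m-++ j ps qs = ≡.trans (≡.cong length (List.filter-++ (j ℕ.≟_) ps qs)) (List.length-++ (filter (j ℕ.≟_) ps))

m-none : ∀ j → All (j ≢_) ps → m j ps ≡ 0
m-none j j∉ps = ≡.cong length (List.filter-none (j ℕ.≟_) j∉ps)

m-replicate : ∀ j a → m j (replicate a j) ≡ a
m-replicate j a =
  ≡.trans (≡.cong length (List.filter-all (j ℕ.≟_) (All.replicate⁺ a ≡.refl))) (List.length-replicate a)

bounded⇒All≤ : ∀ {K} → Linked _≥_ (K ∷ ps) → All (_≤ K) ps
bounded⇒All≤ bounded = All.tail (Linked.Linked⇒All (flip ℕ.≤-trans) ℕ.≤-refl bounded)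

m-above : ∀ {j K} → K < j → Linked _≥_ (K ∷ ps) → m j ps ≡ 0
m-above K<j bounded = m-none _ (All.map (λ p≤K → ℕ.<⇒≢ (ℕ.≤-<-trans p≤K K<j) ∘ ≡.sym) (bounded⇒All≤ bounded))

m-top : ∀ K a → Linked _≥_ (K ∷ qs) → m (suc K) (replicate a (suc K) ++ qs) ≡ a
m-top {qs} K a bounded = begin
  m (suc K) (replicate a (suc K) ++ qs)             ≡⟨ m-++ (suc K) (replicate a (suc K)) qs ⟩
  m (suc K) (replicate a (suc K)) + m (suc K) qs    ≡⟨ ≡.cong₂ _+_ (m-replicate (suc K) a) (m-above ℕ.≤-refl bounded) ⟩
  a + 0                                             ≡⟨ ℕ.+-identityʳ a ⟩
  a                                                 ∎
  where open ≡.≡-Reasoning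

m-below : ∀ {k K} a → k ≤ K → m k (replicate a (suc K) ++ qs) ≡ m k qs
m-below {qs} {k} {K} a k≤K =
  ≡.trans (m-++ k (replicate a (suc K)) qs)
          (≡.cong (_+ m k qs) (m-none k (All.replicate⁺ a (ℕ.<⇒≢ (s≤s k≤K)))))

sum-replicate-++ : ∀ a k qs → sum (replicate a k ++ qs) ≡ a * k + sum qs
sum-replicate-++ zero    k qs = ≡.refl
sum-replicate-++ (suc a) k qs = ≡.trans (≡.cong (_+_ k) (sum-replicate-++ a k qs)) (≡.sym (ℕ.+-assoc k (a * k) (sum qs)))

bounded-replicate : ∀ {K} a → Linked _≥_ (K ∷ qs) → Linked _≥_ (suc K ∷ replicate a (suc K) ++ qs)
bounded-replicate zero    [-]        = [-]
bounded-replicate zero    (p≤K ∷ lk) = ℕ.m≤n⇒m≤1+n p≤K ∷ lk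
bounded-replicate (suc a) lk         = ℕ.≤-refl ∷ bounded-replicate a lk

split-top : ∀ K ps → Linked _≥_ (suc K ∷ ps) →
            ∃[ a ] ∃[ qs ] ps ≡ replicate a (suc K) ++ qs × Linked _≥_ (K ∷ qs)
split-top K []       _ = 0 , [] , ≡.refl , [-]
split-top K (p ∷ ps) (p≤1+K ∷ lk) with p ℕ.≟ suc K
... | no  p≢1+K  = 0 , p ∷ ps , ≡.refl , ℕ.≤-pred (ℕ.≤∧≢⇒< p≤1+K p≢1+K) ∷ lk
... | yes ≡.refl with a , qs , ≡.refl , bounded ← split-top K ps lk = suc a , qs , ≡.refl , bounded

∈-restricted⁻ : ∀ K {n} → ps ∈ restricted S K n → IsRestricted S K n ps
∈-restricted⁻ zero {zero} (here ≡.refl) = isRestricted (isPartition [] [] ≡.refl) [-]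
  λ k 0<k k≤0 → ⊥-elim (ℕ.<⇒≱ 0<k k≤0)
∈-restricted⁻ {S = S} (suc K) {n} ps∈
  with a , a∈S , ps∈a ← find (∈-concatMap⁻ _ {xs = S (suc K)} ps∈)
  with qs , qs∈ , ≡.refl ← ∈-map⁻ _ ps∈a
  with k , ≡.refl , qs∈k ← ∈-delay⁻ (a * suc K) n qs∈
  with isRestricted (isPartition pos _ total) bounded mult ← ∈-restricted⁻ K qs∈k =
  isRestricted
    (isPartition (All.++⁺ (All.replicate⁺ a z<s) pos) (Linked.tail lk)
                 (≡.trans (sum-replicate-++ a (suc K) qs) (≡.cong (_+_ (a * suc K)) total)))
    lk multiplicity
  where
  lk : Linked _≥_ (suc K ∷ replicate a (suc K) ++ qs)
  lk = bounded-replicate a bounded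

  multiplicity : ∀ j → 0 < j → j ≤ suc K → m j (replicate a (suc K) ++ qs) ∈ S j
  multiplicity j 0<j j≤1+K with j ℕ.≟ suc K
  ... | yes ≡.refl = ≡.subst (_∈ S (suc K)) (≡.sym (m-top K a bounded)) a∈S
  ... | no  j≢1+K  = ≡.subst (_∈ S j) (≡.sym (m-below a j≤K)) (mult j 0<j j≤K)
    where
    j≤K = ℕ.≤-pred (ℕ.≤∧≢⇒< j≤1+K j≢1+K)

∈-restricted⁺ : ∀ K {n} → IsRestricted S K n ps → ps ∈ restricted S K n
∈-restricted⁺ {ps = []}     zero (isRestricted (isPartition _ _ ≡.refl) _ _) = here ≡.refl
∈-restricted⁺ {ps = p ∷ ps} zero (isRestricted (isPartition (0<p ∷ _) _ _) (p≤0 ∷ _) _) = ⊥-elim (ℕ.<⇒≱ 0<p p≤0)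
∈-restricted⁺ {S = S} {ps} (suc K) (isRestricted (isPartition pos _ ≡.refl) bounded mult)
  with a , qs , ≡.refl , bounded′ ← split-top K ps bounded =
  ∈-concatMap⁺ _ (lose a∈S (∈-map⁺ _ (≡.subst (λ n → qs ∈ delay (a * suc K) (restricted S K) n)
    (≡.sym (sum-replicate-++ a (suc K) qs))
    (∈-delay⁺ (a * suc K) (∈-restricted⁺ K
      (isRestricted (isPartition (All.++⁻ʳ (replicate a (suc K)) pos) (Linked.tail bounded′) ≡.refl) bounded′
        λ j 0<j j≤K → ≡.subst (_∈ S j) (m-below a j≤K) (mult j 0<j (ℕ.m≤n⇒m≤1+n j≤K))))))))
  where
  a∈S : a ∈ S (suc K)
  a∈S = ≡.subst (_∈ S (suc K)) (m-top K a bounded′) (mult (suc K) z<s ℕ.≤-refl)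

-- The multiplicity of the largest size tells the branches apart, and within a branch prepending a
-- fixed block is injective.
restricted-unique : (∀ k → Unique (S k)) → ∀ K n → Unique (restricted S K n)
restricted-unique S! zero    zero    = [] ∷ []
restricted-unique S! zero    (suc n) = []
restricted-unique {S = S} S! (suc K) n = concatMap-unique (S! (suc K))
  (λ a → Unique.map⁺ (List.++-cancelˡ (replicate a (suc K)) _ _)
                     (delay-unique (a * suc K) (restricted-unique S! K) n))
  (λ z∈a z∈b → ≡.trans (≡.sym (top z∈a)) (top z∈b))
  where
  top : ∀ {a z} → z ∈ map (replicate a (suc K) ++_) (delay (a * suc K) (restricted S K) n) → m (suc K) z ≡ a
  top {a} z∈ with qs , qs∈ , ≡.refl ← ∈-map⁻ _ z∈
             with _ , _ , qs∈k ← ∈-delay⁻ (a * suc K) n qs∈ =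
    m-top K a (IsRestricted.bounded (∈-restricted⁻ K qs∈k))

unique-length : ∀ {xs ys : List A} → Unique xs → Unique ys → (∀ {x} → x ∈ xs → x ∈ ys) → (∀ {x} → x ∈ ys → x ∈ xs) →
                length xs ≡ length ys
unique-length xs! ys! xs⊆ys ys⊆xs = ↭-length (∼bag⇒↭ (unique∧set⇒bag xs! ys! (mk⇔ xs⊆ys ys⊆xs)))

-- The two classes of partitions of n and the comparison of coefficients.

module Counting (n : ℕ) where
  M : ℕ
  M = suc n

  open GeneratingFunctions (truncated-powers {M} z<s) using (weight; gf; ∑; generating-functions-agree)

  -- An exact equality in every degree i, below M or not: disjoint branches add and `delay`
  -- multiplies by a power of q.
  length-restricted : ∀ S K i → + length (restricted S K i) ≡ gf S K i
  length-restricted S zero    zero    = ≡.refl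
  length-restricted S zero    (suc i) = ≡.refl
  length-restricted S (suc K) i       = begin
    + length (restricted S (suc K) i)
      ≡⟨ branches (S (suc K)) ⟩
    convolve (weight (suc K) (S (suc K))) (λ i → + length (restricted S K i)) i
      ≡⟨ convolve-comm (weight (suc K) (S (suc K))) (λ i → + length (restricted S K i)) i ⟩
    convolve (λ i → + length (restricted S K i)) (weight (suc K) (S (suc K))) i
      ≡⟨ convolve-cong i (λ i _ → length-restricted S K i) (λ _ _ → ≡.refl) ⟩
    gf S (suc K) i ∎
    where
    open ≡.≡-Reasoning

    branch : ℕ → List (List ℕ)
    branch a = delay (a * suc K) (restricted S K) i

    branches : ∀ as → + length (concatMap (λ a → map (replicate a (suc K) ++_) (branch a)) as)
                    ≡ convolve (weight (suc K) as) (λ i → + length (restricted S K i)) i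
    branches []       = ≡.sym (convolve-zeroˡ _ i)
    branches (a ∷ as) = begin
      + length (map (replicate a (suc K) ++_) (branch a) ++ rest)
        ≡⟨ ≡.cong +_ (List.length-++ (map (replicate a (suc K) ++_) (branch a))) ⟩
      + (length (map (replicate a (suc K) ++_) (branch a)) + length rest)
        ≡⟨ ℤ.pos-+ _ (length rest) ⟩
      + length (map (replicate a (suc K) ++_) (branch a)) ℤ.+ + length rest
        ≡⟨ ≡.cong₂ ℤ._+_ (≡.trans (≡.cong +_ (List.length-map (replicate a (suc K) ++_) (branch a)))
                                  (length-delay (a * suc K) (restricted S K) i))
                         (branches as) ⟩
      convolve (power (a * suc K)) counts i ℤ.+ convolve (weight (suc K) as) counts i
        ≡⟨ convolve-distribʳ counts (power (a * suc K)) (weight (suc K) as) i ⟨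
      convolve (weight (suc K) (a ∷ as)) counts i ∎
      where
      rest = concatMap (λ a → map (replicate a (suc K) ++_) (branch a)) as
      counts : Series
      counts i = + length (restricted S K i)

  length-concatMap-downFrom : ∀ {A : Set} (f : ℕ → List A) (s : ℕ → Series) i → (∀ j → + length (f j) ≡ s j i) →
                              ∀ k → + length (concatMap f (downFrom k)) ≡ ∑ k s i
  length-concatMap-downFrom f s i f≡s zero    = ≡.refl
  length-concatMap-downFrom f s i f≡s (suc k) = begin
    + length (f k ++ concatMap f (downFrom k))               ≡⟨ ≡.cong +_ (List.length-++ (f k)) ⟩
    + (length (f k) + length (concatMap f (downFrom k)))     ≡⟨ ℤ.pos-+ (length (f k)) _ ⟩
    + length (f k) ℤ.+ + length (concatMap f (downFrom k))   ≡⟨ ≡.cong₂ ℤ._+_ (f≡s k) (length-concatMap-downFrom f s i f≡s k) ⟩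
    s k i ℤ.+ ∑ k s i                                        ≡⟨ ℤ.+-comm (s k i) (∑ k s i) ⟩
    ∑ (suc k) s i                                            ∎
    where open ≡.≡-Reasoning

  bounded-by : ∀ {K} → IsPartition n ps → n ≤ K → Linked _≥_ (K ∷ ps)
  bounded-by {[]}     _                         n≤K = [-]
  bounded-by {p ∷ ps} (isPartition _ lk ≡.refl) n≤K = ℕ.≤-trans (ℕ.m≤m+n p (sum ps)) n≤K ∷ lk

  -- A partition of n has at most n parts, all being positive; so `downFrom M`, which stops at n,
  -- omits no possible multiplicity.
  m<M : ∀ k → IsPartition n ps → m k ps < M
  m<M {ps} k (isPartition pos _ ≡.refl) = s≤s (ℕ.≤-trans (List.length-filter (k ℕ.≟_) ps) (length≤sum pos))
    where
    length≤sum : ∀ {qs} → All (0 <_) qs → length qs ≤ sum qs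
    length≤sum []          = z≤n
    length≤sum (0<q ∷ pos) = ℕ.+-mono-≤ 0<q (length≤sum pos)

  m-∉ : ∀ {k} → ¬ k ∈ ps → m k ps ≡ 0
  m-∉ k∉ps = m-none _ (All.¬Any⇒All¬ _ k∉ps)

  m-∈ : ∀ {k} → k ∈ ps → m k ps ≢ 0
  m-∈ {ps} {k} k∈ps m≡0 with filter (k ℕ.≟_) ps | ∈-filter⁺ (k ℕ.≟_) k∈ps ≡.refl
  m-∈ k∈ps () | _ ∷ _ | _

  2i-1 : ∀ i → 2 * suc i ∸ 1 ≡ 1 + i * 2
  2i-1 i = expand i
    where
    expand : ∀ i → i + suc (i + 0) ≡ 1 + i * 2
    expand = solve-∀

  odd%2 : ∀ i → (2 * suc i ∸ 1) % 2 ≡ 1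
  odd%2 i = ≡.trans (≡.cong (_% 2) (2i-1 i)) ([m+kn]%n≡m%n 1 i 2)

  -- The witness j demands that 2i + 1 occur twice, while the witness i forbids it, since 2i + 1 >
  -- 2i.
  witness≮ : ∀ {i j} → A₃-witness ps i → A₃-witness ps j → ¬ i < j
  witness≮ {ps} {i} {j} (_ , unrepeated) (twice , _) i<j with (2 * suc i ∸ 1) ∈? ps | twice (suc i) z<s i<j
  ... | no  ∉ps | m≡2 with () ← ≡.trans (≡.sym (m-∉ ∉ps)) m≡2
  ... | yes ∈ps | m≡2 with unrepeated _ ∈ps (≡.subst (2 * i <_) (≡.sym (2i-1 i)) (s≤s (ℕ.≤-reflexive (ℕ.*-comm 2 i))))
  ...   | m≤1 rewrite m≡2 with s≤s () ← m≤1

  witness-unique : ∀ {i j} → A₃-witness ps i → A₃-witness ps j → i ≡ j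
  witness-unique {i = i} {j} w w′ with ℕ.<-cmp i j
  ... | tri< i<j _ _ = ⊥-elim (witness≮ w w′ i<j)
  ... | tri≈ _ i≡j _ = i≡j
  ... | tri> _ _ j<i = ⊥-elim (witness≮ w′ w j<i)

  -- A positive witness j forces the part 2j - 1 ≥ j to occur, so j > n would make a part exceed n.
  -- Hence the range `downFrom M` contains every witness.
  witness<M : ∀ {j} → IsPartition n ps → A₃-witness ps j → j < M
  witness<M {ps} {j} partition (twice , _) with j ℕ.<? M
  ... | yes j<M = j<M
  ... | no  j≮M = contradiction (≡.trans (≡.sym (twice j 0<j ℕ.≤-refl)) (m-above n<2j-1 (bounded-by partition ℕ.≤-refl))) λ ()
    where
    n<j : n < j
    n<j = ℕ.≮⇒≥ j≮M
    0<j : 0 < j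
    0<j = ℕ.≤-trans z<s n<j
    n<2j-1 : n < 2 * j ∸ 1
    n<2j-1 = ℕ.≤-trans n<j (≡.subst (_≤ 2 * j ∸ 1) (ℕ.m+n∸n≡m j 1)
      (ℕ.∸-monoˡ-≤ 1 (ℕ.+-monoʳ-≤ j (ℕ.≤-trans 0<j (ℕ.m≤m+n j 0)))))

  A₃-list : List (List ℕ)
  A₃-list = concatMap (λ j → restricted (A₃-multiplicities M j) (M + j * 2) n) (downFrom M)

  witness⇒restricted : ∀ {j} → IsPartition n ps → A₃-witness ps j →
                       IsRestricted (A₃-multiplicities M j) (M + j * 2) n ps
  witness⇒restricted {ps} {j} partition (twice , unrepeated) =
    isRestricted partition (bounded-by partition (ℕ.≤-trans (ℕ.n≤1+n n) (ℕ.m≤m+n M (j * 2)))) multiplicity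
    where
    ≤1⇒∈ : ∀ {a} → a ≤ 1 → a ∈ 1 ∷ 0 ∷ []
    ≤1⇒∈ z≤n       = there (here ≡.refl)
    ≤1⇒∈ (s≤s z≤n) = here ≡.refl

    multiplicity : ∀ k → 0 < k → k ≤ M + j * 2 → m k ps ∈ A₃-multiplicities M j k
    multiplicity k 0<k _ with k ℕ.≤? j * 2 | k % 2 ℕ.≟ 1
    ... | no  k≰2j | _ = ≡.subst (m k ps ∈_) (≡.sym (A₃-multiplicities-large M j k (ℕ.≰⇒> k≰2j))) (≤1⇒∈ m≤1)
      where
      m≤1 : m k ps ≤ 1
      m≤1 with k ∈? ps
      ... | yes k∈ps = unrepeated k k∈ps (≡.subst (_< k) (ℕ.*-comm j 2) (ℕ.≰⇒> k≰2j))
      ... | no  k∉ps = ≡.subst (_≤ 1) (≡.sym (m-∉ k∉ps)) z≤n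
    ... | yes k≤2j | no ¬odd =
      ≡.subst (m k ps ∈_) (≡.sym (A₃-multiplicities-even M j k k≤2j ¬odd)) (∈-downFrom⁺ (m<M k partition))
    ... | yes k≤2j | yes k%2≡1 =
      ≡.subst (m k ps ∈_) (≡.sym (A₃-multiplicities-odd M j k k≤2j k%2≡1))
        -- An odd k is 2i - 1 for i = k / 2 + 1.
        (here (≡.subst (λ k → m k ps ≡ 2) 2i-1≡k (twice (suc (k / 2)) z<s k/2<j)))
      where
      2i-1≡k : 2 * suc (k / 2) ∸ 1 ≡ k
      2i-1≡k = ≡.trans (2i-1 (k / 2)) (≡.sym (≡.trans (m≡m%n+[m/n]*n k 2) (≡.cong (_+ k / 2 * 2) k%2≡1)))
      k/2<j : k / 2 < j
      k/2<j = ℕ.*-cancelʳ-< 2 (k / 2) j (ℕ.≤-trans (ℕ.≤-reflexive (≡.trans (≡.sym (2i-1 (k / 2))) 2i-1≡k)) k≤2j)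

  restricted⇒witness : ∀ {j} → IsRestricted (A₃-multiplicities M j) (M + j * 2) n ps → A₃-witness ps j
  restricted⇒witness {ps} {j} (isRestricted (isPartition pos _ _) bounded mult) = twice , unrepeated
    where
    twice : ∀ i → 1 ≤ i → i ≤ j → m (2 * i ∸ 1) ps ≡ 2
    twice (suc i) _ i<j = only (mult k 0<k (ℕ.≤-trans k≤2j (ℕ.m≤n+m (j * 2) M)))
      where
      k = 2 * suc i ∸ 1
      0<k : 0 < k
      0<k = ≡.subst (0 <_) (≡.sym (2i-1 i)) z<s
      k≤2j : k ≤ j * 2
      k≤2j = ≡.subst (_≤ j * 2) (≡.sym (2i-1 i)) (ℕ.<⇒≤ (ℕ.*-monoˡ-≤ 2 i<j))
      only : ∀ {a} → a ∈ A₃-multiplicities M j k → a ≡ 2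
      only a∈ rewrite A₃-multiplicities-odd M j k k≤2j (odd%2 i) with here a≡2 ← a∈ = a≡2

    unrepeated : ∀ p → p ∈ ps → 2 * j < p → m p ps ≤ 1
    unrepeated p p∈ps 2j<p = few (mult p (All.lookup pos p∈ps) (All.lookup (bounded⇒All≤ bounded) p∈ps))
      where
      few : ∀ {a} → a ∈ A₃-multiplicities M j p → a ≤ 1
      few a∈ rewrite A₃-multiplicities-large M j p (≡.subst (_< p) (ℕ.*-comm 2 j) 2j<p) with a∈
      ... | here ≡.refl         = ℕ.≤-refl
      ... | there (here ≡.refl) = z≤n

  A₃≡length : A₃ n ≡ length A₃-list
  A₃≡length = unique-length (Unique.filter⁺ IsA₃? (partitions-unique n)) A₃-list-unique to from
    where
    multiplicities-unique : ∀ j k → Unique (A₃-multiplicities M j k)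
    multiplicities-unique j k with k ℕ.≤? j * 2 | k % 2 ℕ.≟ 1
    ... | no  k≰2j | _        = ≡.subst Unique (≡.sym (A₃-multiplicities-large M j k (ℕ.≰⇒> k≰2j))) (((λ ()) ∷ []) ∷ [] ∷ [])
    ... | yes k≤2j | yes odd  = ≡.subst Unique (≡.sym (A₃-multiplicities-odd M j k k≤2j odd)) ([] ∷ [])
    ... | yes k≤2j | no  ¬odd = ≡.subst Unique (≡.sym (A₃-multiplicities-even M j k k≤2j ¬odd)) (Unique.downFrom⁺ M)

    member : ∀ {j ps} → ps ∈ restricted (A₃-multiplicities M j) (M + j * 2) n →
             IsRestricted (A₃-multiplicities M j) (M + j * 2) n ps
    member {j} = ∈-restricted⁻ {S = A₃-multiplicities M j} (M + j * 2) {n}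

    witness : ∀ {j ps} → ps ∈ restricted (A₃-multiplicities M j) (M + j * 2) n → A₃-witness ps j
    witness {j} ps∈ = restricted⇒witness (member {j} ps∈)

    A₃-list-unique : Unique A₃-list
    A₃-list-unique = concatMap-unique (Unique.downFrom⁺ M)
      (λ j → restricted-unique (multiplicities-unique j) (M + j * 2) n)
      (λ {i} {j} ps∈i ps∈j → witness-unique (witness {i} ps∈i) (witness {j} ps∈j))

    to : ∀ {ps} → ps ∈ filter IsA₃? (partitions n) → ps ∈ A₃-list
    to ps∈ with ps∈n , j , w ← ∈-filter⁻ IsA₃? {xs = partitions n} ps∈ =
      ∈-concatMap⁺ _ (lose (∈-downFrom⁺ (witness<M (∈-partitions⁻ ps∈n) w))
                           (∈-restricted⁺ (M + j * 2) (witness⇒restricted (∈-partitions⁻ ps∈n) w)))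

    from : ∀ {ps} → ps ∈ A₃-list → ps ∈ filter IsA₃? (partitions n)
    from ps∈ with j , _ , ps∈j ← find (∈-concatMap⁻ _ {xs = downFrom M} ps∈) =
      ∈-filter⁺ IsA₃? (∈-partitions⁺ (IsRestricted.partition (member {j} ps∈j))) (j , witness {j} ps∈j)

  C₃₃-list : List (List ℕ)
  C₃₃-list = restricted (C₃₃-multiplicities M) (M * 7) n

  C₃₃≡length : C₃₃ n ≡ length C₃₃-list
  C₃₃≡length = unique-length (Unique.filter⁺ IsC₃₃? (partitions-unique n))
    (restricted-unique multiplicities-unique (M * 7) n) to from
    where
    multiplicities-unique : ∀ k → Unique (C₃₃-multiplicities M k)
    multiplicities-unique k with admissible (k % 7)
    ... | true  = Unique.downFrom⁺ M
    ... | false = [] ∷ []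

    forbidden : ∀ r → admissible r ≡ false → r ≢ 0 × r ≢ 3 × r ≢ 4 → ⊥
    forbidden 0 _ (r≢0 , _)     = r≢0 ≡.refl
    forbidden 3 _ (_ , r≢3 , _) = r≢3 ≡.refl
    forbidden 4 _ (_ , _ , r≢4) = r≢4 ≡.refl

    allowed : ∀ r → admissible r ≡ true → r ≢ 0 × r ≢ 3 × r ≢ 4
    allowed 1 _ = (λ ()) , (λ ()) , (λ ())
    allowed 2 _ = (λ ()) , (λ ()) , (λ ())
    allowed (suc (suc (suc (suc (suc r))))) _ = (λ ()) , (λ ()) , (λ ())

    to : ∀ {ps} → ps ∈ filter IsC₃₃? (partitions n) → ps ∈ C₃₃-list
    to {ps} ps∈ with ps∈n , c ← ∈-filter⁻ IsC₃₃? {xs = partitions n} ps∈ =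
      ∈-restricted⁺ (M * 7) (isRestricted partition (bounded-by partition (ℕ.≤-trans (ℕ.n≤1+n n) (ℕ.m≤m*n M 7))) multiplicity)
      where
      partition = ∈-partitions⁻ ps∈n

      multiplicity : ∀ k → 0 < k → k ≤ M * 7 → m k ps ∈ C₃₃-multiplicities M k
      multiplicity k _ _ with admissible (k % 7) in eq
      ... | true  = ∈-downFrom⁺ (m<M k partition)
      ... | false = here (m-∉ λ k∈ps → forbidden (k % 7) eq (c k k∈ps))

    from : ∀ {ps} → ps ∈ C₃₃-list → ps ∈ filter IsC₃₃? (partitions n)
    from {ps} ps∈ with isRestricted partition bounded mult ← ∈-restricted⁻ {S = C₃₃-multiplicities M} (M * 7) {n} ps∈ =
      ∈-filter⁺ IsC₃₃? (∈-partitions⁺ partition) residues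
      where
      residues : IsC₃₃ ps
      residues p p∈ps with admissible (p % 7) in eq
                         | mult p (All.lookup (IsPartition.positive partition) p∈ps) (All.lookup (bounded⇒All≤ bounded) p∈ps)
      ... | true  | _          = allowed (p % 7) eq
      ... | false | here m≡0   = ⊥-elim (m-∈ p∈ps m≡0)

  A₃≡C₃₃ : A₃ n ≡ C₃₃ n
  A₃≡C₃₃ = ℤ.+-injective (begin
    + A₃ n
      ≡⟨ ≡.cong +_ A₃≡length ⟩
    + length A₃-list
      ≡⟨ length-concatMap-downFrom (λ j → restricted (A₃-multiplicities M j) (M + j * 2) n)
           (λ j → gf (A₃-multiplicities M j) (M + j * 2)) n
           (λ j → length-restricted (A₃-multiplicities M j) (M + j * 2) n) M ⟩
    ∑ M (λ j → gf (A₃-multiplicities M j) (M + j * 2)) n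
      -- Here the truncation enters: the series agree below degree M = n + 1, which just includes
      -- the coefficient n.
      ≡⟨ generating-functions-agree n ℕ.≤-refl ⟩
    gf (C₃₃-multiplicities M) (M * 7) n
      ≡⟨ length-restricted (C₃₃-multiplicities M) (M * 7) n ⟨
    + length C₃₃-list
      ≡⟨ ≡.cong +_ C₃₃≡length ⟨
    + C₃₃ n ∎)
    where open ≡.≡-Reasoning

theorem5 : (n : ℕ) → A₃ n ≡ C₃₃ n
theorem5 = Counting.A₃≡C₃₃
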